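{- Let $G$ be a finite simple edge-twin-free graph with $m$ edges and no isolated edge. Then $\gamma'_{t,L}(G)\le\frac{2}{3}m$.
   Context: An isolated edge of $G$ is an edge both of whose ends have degree $1$. For an edge $e$, $N(e)$ is the set of edges different from $e$ sharing an end with $e$, and $N[e]=N(e)\cup\{e\}$. Distinct edges $e,f$ are edge-twins if $N(e)=N(f)$ or $N[e]=N[f]$; $G$ is edge-twin-free if it has no pair of edge-twins. A set $D\subseteq E(G)$ is an edge-locating-total-dominating set if every edge of $E(G)$ (including those in $D$) shares an end with some edge of $D$ other than itself, and for every two distinct edges $e,f\in E(G)\setminus D$ we have $N(e)\cap D\neq N(f)\cap D$. The edge-location total domination number $\gamma'_{t,L}(G)$ is the minimum cardinality of such a set. -}

module Defs where

open import Data.Nat using (ℕ)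
open import Data.Fin using (Fin)
open import Data.Fin.Properties using (_≟_)
open import Data.Fin.Subset using (Subset; _∈_; _∉_; ∣_∣)
open import Data.Vec using (tabulate)
open import Data.Bool using (_∨_)
open import Data.Product using (_×_; ∃-syntax; _,_)
open import Data.Sum using (_⊎_)
open import Relation.Nullary using (¬_)
open import Relation.Nullary.Decidable using (⌊_⌋)
open import Relation.Binary.PropositionalEquality using (_≡_; _≢_)
open import Function.Bundles using (_⇔_)

record Graph (n m : ℕ) : Set where
  field
    end₁ end₂ : Fin m → Fin n
    loopless : ∀ e → end₁ e ≢ end₂ e
    simple : ∀ e f → end₁ e ≡ end₁ f → end₂ e ≡ end₂ f → e ≡ f
    simple′ : ∀ e f → end₁ e ≡ end₂ f → end₂ e ≡ end₁ f → e ≡ f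

module _ {n m : ℕ} (G : Graph n m) where
  open Graph G

  IsEnd : Fin n → Fin m → Set
  IsEnd v e = (v ≡ end₁ e) ⊎ (v ≡ end₂ e)

  incident : Fin n → Subset m
  incident v = tabulate (λ e → ⌊ v ≟ end₁ e ⌋ ∨ ⌊ v ≟ end₂ e ⌋)

  degree : Fin n → ℕ
  degree v = ∣ incident v ∣

  ShareEnd : Fin m → Fin m → Set
  ShareEnd e f = ∃[ v ] (IsEnd v e × IsEnd v f)

  InN : Fin m → Fin m → Set
  InN e f = (f ≢ e) × ShareEnd e f

  InNc : Fin m → Fin m → Set
  InNc e f = (f ≡ e) ⊎ InN e f

  IsolatedEdge : Fin m → Set
  IsolatedEdge e = (degree (end₁ e) ≡ 1) × (degree (end₂ e) ≡ 1)

  NoIsolatedEdge : Set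
  NoIsolatedEdge = ∀ e → ¬ IsolatedEdge e

  EdgeTwins : Fin m → Fin m → Set
  EdgeTwins e f = (e ≢ f) ×
    ((∀ g → InN e g ⇔ InN f g) ⊎ (∀ g → InNc e g ⇔ InNc f g))

  EdgeTwinFree : Set
  EdgeTwinFree = ∀ e f → ¬ EdgeTwins e f

  IsELTD : Subset m → Set
  IsELTD D =
    (∀ e → ∃[ d ] (d ∈ D × InN e d)) ×
    (∀ e f → e ≢ f → e ∉ D → f ∉ D →
       ¬ (∀ g → g ∈ D → (InN e g ⇔ InN f g)))

{-# OPTIONS --safe #-}
{- Call a vertex cold if no edge of D meets it, and near if it has a cold neighbour. First relax the
   problem: D need only be total dominating, with at most one cold neighbour at every vertex. Take
   such a D minimising, in this order, |D|, the number of vertices met by D, and the number of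
   vertices of D-degree at least two.

   The only unlocated pairs left by D come from cherries: D-components x-v-y with xy an edge and v
   near. Adding every such xy to D gives an edge-locating-total-dominating set D⁺.

   To bound |D⁺|, split every edge outside D⁺ into two darts. Minimality of |D| forces every D-edge
   to contain a D-leaf or to meet, at a vertex of D-degree two, a D-edge containing one. Hence the
   edges of D⁺ are claimed by the D-leaves whose D-neighbour has D-degree at least three (one edge
   each) and by the vertices of D-degree two next to a D-leaf (two edges each, three if their cherry
   was repaired). A D-leaf outside the cherries is near or adjacent to a near vertex, as otherwise
   its edge could be dropped from D; the darts found there, and for cherries the second minimality
   and twin-freeness, pay for all claims. So |D⁺| ≤ 2(m - |D⁺|). -}
module Submission where

open import Defs
open import Data.Bool using (Bool; true; false)
open import Data.Empty using (⊥; ⊥-elim)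
open import Data.Fin using (Fin; zero; suc)
open import Data.Fin.Properties using (_≟_; any?; all?; injective⇒≤; suc-injective)
open import Data.Fin.Subset using (Subset; inside; outside; _∈_; _∉_; _⊆_; _∪_; ∁; ⊤; ⁅_⁆; ∣_∣)
open import Data.Fin.Subset.Properties
  using (_∈?_; ∈⊤; anySubset?; ⊆-antisym; x∈⁅x⁆; x∈⁅y⁆⇒x≡y; ∣⁅x⁆∣≡1; x∈p∪q⁻; x∈p∪q⁺;
         p⊆q⇒∣p∣≤∣q∣; p⊂q⇒∣p∣<∣q∣; ∣∁p∣≡n∸∣p∣; ∣p∣≤n; x∉p⇒x∈∁p)
open import Data.List using (List; []; _∷_; _++_; map; length; lookup; concatMap; allFin)
open import Data.List.Properties using (length-++; length-map)
open import Data.List.Membership.Propositional using () renaming (_∈_ to _∈ˡ_)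
open import Data.List.Membership.Propositional.Properties
  using (∈-map⁺; ∈-map⁻; ∈-++⁺ˡ; ∈-++⁺ʳ; ∈-++⁻; ∈-lookup; ∈-concatMap⁺; ∈-allFin)
open import Data.List.Membership.Setoid.Properties using (index-injective)
open import Data.List.Relation.Unary.All as All using (All; []; _∷_)
open import Data.List.Relation.Unary.AllPairs using ([]; _∷_)
open import Data.List.Relation.Unary.Any as Any using (here; there)
open import Data.List.Relation.Unary.Unique.Propositional using (Unique)
import Data.List.Relation.Unary.Unique.Propositional.Properties as Uniqueₚ
open import Data.Nat using (ℕ; suc; _+_; _*_; _∸_; _≤_; _<_; z≤n; s≤s; _<?_; _≤?_)
open import Data.Nat.Induction using (<-wellFounded)
open import Data.Nat.Properties
  using (≤-refl; m≤n⇒m≤1+n; ≤-trans; <⇒≱; ≮⇒≥; +-mono-≤; +-monoˡ-≤; +-suc; +-comm;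
         +-identityʳ; m∸n+n≡m; *-distribˡ-+; module ≤-Reasoning)
open import Data.Product using (_×_; _,_; ∃-syntax; proj₁; proj₂)
open import Data.Sum using (_⊎_; inj₁; inj₂; [_,_]′)
open import Data.Vec using ([]; _∷_; here; there; tabulate)
open import Data.Vec.Properties using (lookup∘tabulate; []=⇒lookup; lookup⇒[]=)
open import Function using (_∘_)
open import Function.Bundles using (mk⇔; Equivalence)
open import Induction.WellFounded using (Acc; acc)
open import Relation.Binary.PropositionalEquality
  using (_≡_; _≢_; refl; sym; trans; cong; cong₂; subst; ≢-sym; setoid; module ≡-Reasoning)
open import Relation.Nullary using (¬_; Dec; yes; no; does; contradiction; _because_; Reflects; ofʸ; ofⁿ)
open import Relation.Nullary.Decidable
  using (map′; _×-dec_; _⊎-dec_; _→-dec_; ¬?; decidable-stable; dec-true; isYes)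
open import Relation.Unary using (Decidable)

private variable
  n m : ℕ
  A B K : Set

-- Counting with duplicate-free lists.

lookup-injective : {xs : List A} → Unique xs → ∀ i j → lookup xs i ≡ lookup xs j → i ≡ j
lookup-injective (_ ∷ _) zero zero _ = refl
lookup-injective (x∉ ∷ _) zero (suc j) eq = contradiction eq (All.lookup x∉ (∈-lookup j))
lookup-injective (x∉ ∷ _) (suc i) zero eq = contradiction (sym eq) (All.lookup x∉ (∈-lookup i))
lookup-injective (_ ∷ u) (suc i) (suc j) eq = cong suc (lookup-injective u i j eq)

unique-⊆⇒length≤ : {xs ys : List A} → Unique xs → (∀ {x} → x ∈ˡ xs → x ∈ˡ ys) → length xs ≤ length ys
unique-⊆⇒length≤ {xs = xs} u sub =
  injective⇒≤ {f = λ i → Any.index (sub (∈-lookup {xs = xs} i))}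
    (λ {i} {j} eq → lookup-injective u i j (index-injective (setoid _) (sub (∈-lookup i)) (sub (∈-lookup j)) eq))

module _ (f : K → List B) where

  length-concatMap-mono : (g : K → List A) → (∀ k → length (g k) ≤ length (f k)) →
    ∀ ks → length (concatMap g ks) ≤ length (concatMap f ks)
  length-concatMap-mono g g≤f [] = z≤n
  length-concatMap-mono g g≤f (k ∷ ks)
    rewrite length-++ (g k) {concatMap g ks} | length-++ (f k) {concatMap f ks} =
    +-mono-≤ (g≤f k) (length-concatMap-mono g g≤f ks)

  ∈-concatMap⇒∃ : ∀ ks {y} → y ∈ˡ concatMap f ks → ∃[ k ] (k ∈ˡ ks × y ∈ˡ f k)
  ∈-concatMap⇒∃ (k ∷ ks) y∈ with ∈-++⁻ (f k) y∈
  ... | inj₁ y∈k = k , here refl , y∈k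
  ... | inj₂ y∈ks with ∈-concatMap⇒∃ ks y∈ks
  ...   | l , l∈ , y∈l = l , there l∈ , y∈l

  ∈-concatMap : ∀ {ks k y} → k ∈ˡ ks → y ∈ˡ f k → y ∈ˡ concatMap f ks
  ∈-concatMap k∈ y∈ = ∈-concatMap⁺ f (Any.map (λ { refl → y∈ }) k∈)

  unique-concatMap : (∀ k → Unique (f k)) → (∀ {k l y} → y ∈ˡ f k → y ∈ˡ f l → k ≡ l) →
    ∀ {ks} → Unique ks → Unique (concatMap f ks)
  unique-concatMap u disj [] = []
  unique-concatMap u disj {k ∷ ks} (k∉ ∷ uks) =
    Uniqueₚ.++⁺ (u k) (unique-concatMap u disj uks) λ { (y∈k , y∈ks) →
      let l , l∈ , y∈l = ∈-concatMap⇒∃ ks y∈ks in All.lookup k∉ l∈ (disj y∈k y∈l) }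

-- Finite subsets: enumeration, comprehension, exchange, minimisation.

elements : Subset n → List (Fin n)
elements [] = []
elements (inside ∷ p) = zero ∷ map suc (elements p)
elements (outside ∷ p) = map suc (elements p)

length-elements : (p : Subset n) → length (elements p) ≡ ∣ p ∣
length-elements [] = refl
length-elements (inside ∷ p) = cong suc (trans (length-map suc (elements p)) (length-elements p))
length-elements (outside ∷ p) = trans (length-map suc (elements p)) (length-elements p)

elements-unique : (p : Subset n) → Unique (elements p)
elements-unique [] = []
elements-unique (inside ∷ p) =
  All.tabulate (λ y∈ eq → case-suc (∈-map⁻ suc y∈) eq) ∷ Uniqueₚ.map⁺ suc-injective (elements-unique p)
  where
  case-suc : ∀ {y} → ∃[ x ] (x ∈ˡ elements p × y ≡ suc x) → zero ≢ y
  case-suc (_ , _ , refl) ()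
elements-unique (outside ∷ p) = Uniqueₚ.map⁺ suc-injective (elements-unique p)

∈⇒∈elements : {p : Subset n} {x : Fin n} → x ∈ p → x ∈ˡ elements p
∈⇒∈elements here = here refl
∈⇒∈elements {p = inside ∷ p} (there x∈) = there (∈-map⁺ suc (∈⇒∈elements x∈))
∈⇒∈elements {p = outside ∷ p} (there x∈) = ∈-map⁺ suc (∈⇒∈elements x∈)

∈elements⇒∈ : (p : Subset n) {x : Fin n} → x ∈ˡ elements p → x ∈ p
∈elements⇒∈ (inside ∷ p) (here refl) = here
∈elements⇒∈ (inside ∷ p) (there x∈) with ∈-map⁻ suc x∈
... | _ , y∈ , refl = there (∈elements⇒∈ p y∈)
∈elements⇒∈ (outside ∷ p) x∈ with ∈-map⁻ suc x∈
... | _ , y∈ , refl = there (∈elements⇒∈ p y∈)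

⟦_⟧ : {P : Fin n → Set} → Decidable P → Subset n
⟦ P? ⟧ = tabulate (λ x → does (P? x))

module _ {P : Fin n → Set} (P? : Decidable P) where

  ∈⟦⟧⁺ : ∀ {x} → P x → x ∈ ⟦ P? ⟧
  ∈⟦⟧⁺ {x} px = lookup⇒[]= x _ (trans (lookup∘tabulate _ x) (dec-true (P? x) px))

  ∈⟦⟧⁻ : ∀ {x} → x ∈ ⟦ P? ⟧ → P x
  ∈⟦⟧⁻ {x} x∈ with P? x | trans (sym (lookup∘tabulate (λ y → does (P? y)) x)) ([]=⇒lookup x∈)
  ... | yes px | _ = px
  ... | no _ | ()

∣p∪q∣≤∣p∣+∣q∣ : (p q : Subset n) → ∣ p ∪ q ∣ ≤ ∣ p ∣ + ∣ q ∣
∣p∪q∣≤∣p∣+∣q∣ [] [] = z≤n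
∣p∪q∣≤∣p∣+∣q∣ (outside ∷ p) (outside ∷ q) = ∣p∪q∣≤∣p∣+∣q∣ p q
∣p∪q∣≤∣p∣+∣q∣ (outside ∷ p) (inside ∷ q) rewrite +-suc ∣ p ∣ ∣ q ∣ = s≤s (∣p∪q∣≤∣p∣+∣q∣ p q)
∣p∪q∣≤∣p∣+∣q∣ (inside ∷ p) (outside ∷ q) = s≤s (∣p∪q∣≤∣p∣+∣q∣ p q)
∣p∪q∣≤∣p∣+∣q∣ (inside ∷ p) (inside ∷ q) rewrite +-suc ∣ p ∣ ∣ q ∣ =
  s≤s (m≤n⇒m≤1+n (∣p∪q∣≤∣p∣+∣q∣ p q))

without? : (D : Subset n) (e : Fin n) → Decidable (λ f → f ∈ D × f ≢ e)
without? D e f = (f ∈? D) ×-dec ¬? (f ≟ e)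

_without_ : Subset n → Fin n → Subset n
D without e = ⟦ without? D e ⟧

swap : Subset n → Fin n → Fin n → Subset n
swap D e g = D without e ∪ ⁅ g ⁆

module _ (D : Subset n) (e : Fin n) where

  ∈-without⁺ : ∀ {f} → f ∈ D → f ≢ e → f ∈ D without e
  ∈-without⁺ f∈ f≢ = ∈⟦⟧⁺ (without? D e) (f∈ , f≢)

  ∈-without⁻ : ∀ {f} → f ∈ D without e → f ∈ D × f ≢ e
  ∈-without⁻ = ∈⟦⟧⁻ (without? D e)

  ∣without∣< : e ∈ D → ∣ D without e ∣ < ∣ D ∣
  ∣without∣< e∈ = p⊂q⇒∣p∣<∣q∣
    ((λ f∈ → proj₁ (∈-without⁻ f∈)) , e , e∈ , λ e∈′ → proj₂ (∈-without⁻ e∈′) refl)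

  module _ (g : Fin n) where

    ∈-swap⁺ : ∀ {f} → f ∈ D → f ≢ e → f ∈ swap D e g
    ∈-swap⁺ f∈ f≢ = x∈p∪q⁺ (inj₁ (∈-without⁺ f∈ f≢))

    ∈-swap-new : g ∈ swap D e g
    ∈-swap-new = x∈p∪q⁺ (inj₂ (x∈⁅x⁆ g))

    ∈-swap⁻ : ∀ {f} → f ∈ swap D e g → (f ∈ D × f ≢ e) ⊎ f ≡ g
    ∈-swap⁻ f∈ with x∈p∪q⁻ (D without e) ⁅ g ⁆ f∈
    ... | inj₁ f∈′ = inj₁ (∈-without⁻ f∈′)
    ... | inj₂ f∈g = inj₂ (x∈⁅y⁆⇒x≡y g f∈g)

    -- Only an inequality, as `g` may already lie in `D`.
    ∣swap∣≤ : e ∈ D → ∣ swap D e g ∣ ≤ ∣ D ∣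
    ∣swap∣≤ e∈ = begin
      ∣ swap D e g ∣                 ≤⟨ ∣p∪q∣≤∣p∣+∣q∣ (D without e) ⁅ g ⁆ ⟩
      ∣ D without e ∣ + ∣ ⁅ g ⁆ ∣    ≡⟨ cong (∣ D without e ∣ +_) (∣⁅x⁆∣≡1 g) ⟩
      ∣ D without e ∣ + 1            ≡⟨ +-comm ∣ D without e ∣ 1 ⟩
      suc ∣ D without e ∣            ≤⟨ ∣without∣< e∈ ⟩
      ∣ D ∣                          ∎
      where open ≤-Reasoning

minimizer : {P : Subset m → Set} → Decidable P → (μ : Subset m → ℕ) → ∀ D → P D →
  ∃[ D′ ] (P D′ × (∀ D″ → P D″ → μ D′ ≤ μ D″))
minimizer {P = P} P? μ D pD = go D pD (<-wellFounded (μ D))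
  where
  go : ∀ D → P D → Acc _<_ (μ D) → ∃[ D′ ] (P D′ × (∀ D″ → P D″ → μ D′ ≤ μ D″))
  go D pD (acc smaller) with anySubset? (λ D′ → P? D′ ×-dec (μ D′ <? μ D))
  ... | yes (D′ , pD′ , lt) = go D′ pD′ (smaller lt)
  ... | no none = D , pD , λ D″ pD″ → ≮⇒≥ (λ lt → none (D″ , pD″ , lt))

-- incident is built from ⌊_⌋, which is not definitionally the does field of the decision.
via-isYes : Dec A → Dec A
via-isYes a? = isYes a? because reflects a?
  where
  reflects : (a? : Dec A) → Reflects A (isYes a?)
  reflects (yes a) = ofʸ a
  reflects (no ¬a) = ofⁿ ¬a

-- Incidence, hot and cold vertices, and the relaxed problem.

module Incidence (G : Graph n m) where
  open Graph G

  infix 4 _at_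
  _at_ : Fin n → Fin m → Set
  v at e = IsEnd G v e

  at? : ∀ v e → Dec (v at e)
  at? v e = (v ≟ end₁ e) ⊎-dec (v ≟ end₂ e)

  -- The ends may be named in either order, so arguments need not distinguish `end₁` from `end₂`.
  record Joins (e : Fin m) (u v : Fin n) : Set where
    constructor joins
    field
      left : u at e
      right : v at e
      distinct : u ≢ v
  open Joins public

  joins? : ∀ e u v → Dec (Joins e u v)
  joins? e u v = map′ (λ (l , r , d) → joins l r d) (λ j → left j , right j , distinct j)
    (at? u e ×-dec (at? v e ×-dec ¬? (u ≟ v)))

  flip : ∀ {e u v} → Joins e u v → Joins e v u
  flip (joins l r d) = joins r l (≢-sym d)

  end-of : ∀ {e u v w} → Joins e u v → w at e → w ≡ u ⊎ w ≡ v
  end-of (joins (inj₁ refl) (inj₁ refl) u≢v) _ = contradiction refl u≢v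
  end-of (joins (inj₁ refl) (inj₂ refl) _) (inj₁ refl) = inj₁ refl
  end-of (joins (inj₁ refl) (inj₂ refl) _) (inj₂ refl) = inj₂ refl
  end-of (joins (inj₂ refl) (inj₁ refl) _) (inj₁ refl) = inj₂ refl
  end-of (joins (inj₂ refl) (inj₁ refl) _) (inj₂ refl) = inj₁ refl
  end-of (joins (inj₂ refl) (inj₂ refl) u≢v) _ = contradiction refl u≢v

  joins-unique : ∀ {e f u v} → Joins e u v → Joins f u v → e ≡ f
  joins-unique (joins (inj₁ a) (inj₁ b) u≢v) _ = contradiction (trans a (sym b)) u≢v
  joins-unique (joins (inj₂ a) (inj₂ b) u≢v) _ = contradiction (trans a (sym b)) u≢v
  joins-unique _ (joins (inj₁ a) (inj₁ b) u≢v) = contradiction (trans a (sym b)) u≢v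
  joins-unique _ (joins (inj₂ a) (inj₂ b) u≢v) = contradiction (trans a (sym b)) u≢v
  joins-unique {e} {f} (joins (inj₁ a) (inj₂ b) _) (joins (inj₁ c) (inj₂ d) _) =
    simple e f (trans (sym a) c) (trans (sym b) d)
  joins-unique {e} {f} (joins (inj₁ a) (inj₂ b) _) (joins (inj₂ c) (inj₁ d) _) =
    simple′ e f (trans (sym a) c) (trans (sym b) d)
  joins-unique {e} {f} (joins (inj₂ a) (inj₁ b) _) (joins (inj₁ c) (inj₂ d) _) =
    simple′ e f (trans (sym b) d) (trans (sym a) c)
  joins-unique {e} {f} (joins (inj₂ a) (inj₁ b) _) (joins (inj₂ c) (inj₁ d) _) =
    simple e f (trans (sym b) d) (trans (sym a) c)

  other-end : ∀ {e u} → u at e → ∃[ v ] Joins e u v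
  other-end {e} (inj₁ refl) = end₂ e , joins (inj₁ refl) (inj₂ refl) (loopless e)
  other-end {e} (inj₂ refl) = end₁ e , joins (inj₂ refl) (inj₁ refl) (≢-sym (loopless e))

  far-end : ∀ {e u v w} → Joins e u v → w at e → w ≢ u → w ≡ v
  far-end j w∈ w≢u with end-of j w∈
  ... | inj₁ w≡u = contradiction w≡u w≢u
  ... | inj₂ w≡v = w≡v

  joins-cancel : ∀ {e u v w} → Joins e u v → Joins e u w → w ≡ v
  joins-cancel j k = far-end j (right k) (≢-sym (distinct k))

  avoids : ∀ {e u v w} → Joins e u v → w ≢ u → w ≢ v → ¬ w at e
  avoids j w≢u w≢v w∈ = [ w≢u , w≢v ]′ (end-of j w∈)

  ends : ∀ e → Joins e (end₁ e) (end₂ e)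
  ends e = joins (inj₁ refl) (inj₂ refl) (loopless e)

  adjacent? : ∀ e f → Dec (InN G e f)
  adjacent? e f = ¬? (f ≟ e) ×-dec any? (λ v → at? v e ×-dec at? v f)

  Hot : Subset m → Fin n → Set
  Hot D v = ∃[ e ] (e ∈ D × v at e)

  hot? : ∀ D → Decidable (Hot D)
  hot? D v = any? λ e → (e ∈? D) ×-dec at? v e

  ColdNbr : Subset m → Fin n → Fin n → Set
  ColdNbr D u w = (∃[ e ] Joins e u w) × ¬ Hot D w

  coldNbr? : ∀ D u w → Dec (ColdNbr D u w)
  coldNbr? D u w = any? (λ e → joins? e u w) ×-dec ¬? (hot? D w)

  Near : Subset m → Fin n → Set
  Near D u = ∃[ w ] ColdNbr D u w

  near? : ∀ D → Decidable (Near D)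
  near? D u = any? (coldNbr? D u)

  Dominating : Subset m → Set
  Dominating D = ∀ e → ∃[ d ] (d ∈ D × InN G e d)

  -- This stands in for location: two edges outside `D` from `u` to distinct cold vertices would
  -- both have exactly the `D`-edges at `u` as `D`-neighbours.
  Packed : Subset m → Set
  Packed D = ∀ u w w′ → ColdNbr D u w → ColdNbr D u w′ → w ≡ w′

  Valid : Subset m → Set
  Valid D = Dominating D × Packed D


  valid? : Decidable Valid
  valid? D =
    all? (λ e → any? λ d → (d ∈? D) ×-dec adjacent? e d) ×-dec
    all? (λ u → all? λ w → all? λ w′ → coldNbr? D u w →-dec (coldNbr? D u w′ →-dec (w ≟ w′)))

  Multi : Subset m → Fin n → Set
  Multi D v = ∃[ e ] ∃[ f ] (e ∈ D × v at e × f ∈ D × v at f × f ≢ e)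

  multi? : ∀ D → Decidable (Multi D)
  multi? D v = any? λ e → any? λ f →
    (e ∈? D) ×-dec (at? v e ×-dec ((f ∈? D) ×-dec (at? v f ×-dec ¬? (f ≟ e))))

  module _ (no-isolated : NoIsolatedEdge G) where

    has-neighbour : ∀ e → ∃[ d ] InN G e d
    has-neighbour e with any? (adjacent? e)
    ... | yes found = found
    ... | no none = contradiction (only-e (inj₁ refl) , only-e (inj₂ refl)) (no-isolated e)
      where
      inc? : ∀ v f → Dec (v at f)
      inc? v f = via-isYes (v ≟ end₁ f) ⊎-dec via-isYes (v ≟ end₂ f)
      only-e : ∀ {v} → v at e → degree G v ≡ 1
      only-e {v} v∈e = trans (cong ∣_∣ (⊆-antisym ⊆e e⊆)) (∣⁅x⁆∣≡1 e)
        where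
        ⊆e : incident G v ⊆ ⁅ e ⁆
        ⊆e {f} f∈ with f ≟ e
        ... | yes refl = x∈⁅x⁆ e
        ... | no f≢e = contradiction (f , f≢e , v , v∈e , ∈⟦⟧⁻ (inc? v) f∈) none
        e⊆ : ⁅ e ⁆ ⊆ incident G v
        e⊆ {f} f∈ with x∈⁅y⁆⇒x≡y e f∈
        ... | refl = ∈⟦⟧⁺ (inc? v) v∈e

    -- The starting point of the minimisation. Packing is vacuous, since every vertex with an edge
    -- is hot for `⊤`.
    ⊤-valid : Valid ⊤
    ⊤-valid = (λ e → let d , adj = has-neighbour e in d , ∈⊤ , adj)
            , λ { u w w′ ((e , j) , cold) _ → contradiction (e , ∈⊤ , right j) cold }

-- Vertex degrees counted in `D`.

module Degrees (G : Graph n m) (D : Subset m) where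
  open Incidence G

  record Leaf (x : Fin n) (e : Fin m) : Set where
    constructor leaf
    field
      mem : e ∈ D
      end : x at e
      only : ∀ f → f ∈ D → x at f → f ≡ e

  record Two (x : Fin n) (e f : Fin m) : Set where
    constructor two
    field
      mem₁ : e ∈ D
      mem₂ : f ∈ D
      end₁ : x at e
      end₂ : x at f
      differ : f ≢ e
      only : ∀ g → g ∈ D → x at g → g ≡ e ⊎ g ≡ f

  -- D-degree at least two, respectively three, phrased without counting: no single edge,
  -- respectively no pair of edges, exhausts the D-edges at x.
  Many : Fin n → Set
  Many x = ∀ e → ∃[ f ] (f ∈ D × x at f × f ≢ e)

  Three : Fin n → Set
  Three x = ∀ e f → ∃[ g ] (g ∈ D × x at g × g ≢ e × g ≢ f)

  data Degree (x : Fin n) : Set where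
    untouched : ¬ Hot D x → Degree x
    one : ∀ e → Leaf x e → Degree x
    couple : ∀ e f → Two x e f → Degree x
    several : Three x → Degree x

  leaf? : ∀ x e → Dec (Leaf x e)
  leaf? x e = map′ (λ (a , b , c) → leaf a b c) (λ (leaf a b c) → a , b , c)
    ((e ∈? D) ×-dec (at? x e ×-dec all? λ f → (f ∈? D) →-dec (at? x f →-dec (f ≟ e))))

  two? : ∀ x e f → Dec (Two x e f)
  two? x e f = map′ (λ (a , b , c , d , p , q) → two a b c d p q) (λ (two a b c d p q) → a , b , c , d , p , q)
    ((e ∈? D) ×-dec ((f ∈? D) ×-dec (at? x e ×-dec (at? x f ×-dec (¬? (f ≟ e) ×-dec
      all? λ g → (g ∈? D) →-dec (at? x g →-dec ((g ≟ e) ⊎-dec (g ≟ f))))))))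

  three : ∀ {x a b c} → a ∈ D → x at a → b ∈ D → x at b → c ∈ D → x at c →
    b ≢ a → c ≢ a → c ≢ b → Three x
  three {x} {a} {b} {c} a∈ xa b∈ xb c∈ xc b≢a c≢a c≢b e f with a ≟ e | a ≟ f | b ≟ e | b ≟ f
  ... | no a≢e | no a≢f | _ | _ = a , a∈ , xa , a≢e , a≢f
  ... | _ | _ | no b≢e | no b≢f = b , b∈ , xb , b≢e , b≢f
  ... | yes refl | _ | yes b≡e | _ = contradiction b≡e b≢a
  ... | _ | yes refl | _ | yes b≡f = contradiction b≡f b≢a
  ... | yes refl | _ | _ | yes refl = c , c∈ , xc , c≢a , c≢b
  ... | _ | yes refl | yes refl | _ = c , c∈ , xc , c≢b , c≢a

  another? : ∀ x e → Dec (∃[ f ] (f ∈ D × x at f × f ≢ e))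
  another? x e = any? λ f → (f ∈? D) ×-dec (at? x f ×-dec ¬? (f ≟ e))

  leaf-or-another : ∀ {x e} → e ∈ D → x at e → Leaf x e ⊎ ∃[ f ] (f ∈ D × x at f × f ≢ e)
  leaf-or-another {x} {e} e∈ xe with another? x e
  ... | yes found = inj₂ found
  ... | no unique = inj₁ (leaf e∈ xe λ f f∈ xf → decidable-stable (f ≟ e) λ f≢e → unique (f , f∈ , xf , f≢e))

  degree-of : ∀ x → Degree x
  degree-of x with hot? D x
  ... | no cold = untouched cold
  ... | yes (e , e∈ , xe) with leaf-or-another e∈ xe
  ...   | inj₁ l = one e l
  ...   | inj₂ (f , f∈ , xf , f≢e)
    with any? (λ g → (g ∈? D) ×-dec (at? x g ×-dec (¬? (g ≟ e) ×-dec ¬? (g ≟ f))))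
  ...     | yes (g , g∈ , xg , g≢e , g≢f) = several (three e∈ xe f∈ xf g∈ xg f≢e g≢e g≢f)
  ...     | no unique = couple e f (two e∈ f∈ xe xf f≢e only)
    where
    only : ∀ g → g ∈ D → x at g → g ≡ e ⊎ g ≡ f
    only g g∈ xg with g ≟ e | g ≟ f
    ... | yes g≡e | _ = inj₁ g≡e
    ... | no _ | yes g≡f = inj₂ g≡f
    ... | no g≢e | no g≢f = contradiction (g , g∈ , xg , g≢e , g≢f) unique

  leaf-not-many : ∀ {x e} → Leaf x e → ¬ Many x
  leaf-not-many {e = e} l many = let f , f∈ , xf , f≢e = many e in f≢e (Leaf.only l f f∈ xf)

  three⇒many : ∀ {x} → Three x → Many x
  three⇒many t e = let f , f∈ , xf , f≢e , _ = t e e in f , f∈ , xf , f≢e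

  two⇒many : ∀ {x e f} → Two x e f → Many x
  two⇒many {e = e} {f} (two e∈ f∈ xe xf f≢e _) g with e ≟ g
  ... | no e≢g = e , e∈ , xe , e≢g
  ... | yes refl = f , f∈ , xf , f≢e

  two-not-three : ∀ {x e f} → Two x e f → ¬ Three x
  two-not-three {e = e} {f} t three′ with three′ e f
  ... | g , g∈ , xg , g≢e , g≢f = [ g≢e , g≢f ]′ (Two.only t g g∈ xg)

  leaf-unique : ∀ {x e f} → Leaf x e → Leaf x f → e ≡ f
  leaf-unique {e = e} l l′ = Leaf.only l′ e (Leaf.mem l) (Leaf.end l)

  two-swap : ∀ {x e f} → Two x e f → Two x f e
  two-swap (two a b c d p q) = two b a d c (≢-sym p) λ g g∈ xg → [ inj₂ , inj₁ ]′ (q g g∈ xg)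

  two-through : ∀ {x e f g} → Two x e f → g ∈ D → x at g → ∃[ h ] Two x g h
  two-through {e = e} {f} {g} t g∈ xg with Two.only t g g∈ xg
  ... | inj₁ refl = f , t
  ... | inj₂ refl = e , two-swap t

  two-cancel : ∀ {x e f h} → Two x e f → Two x e h → f ≡ h
  two-cancel {f = f} t t′ with Two.only t′ f (Two.mem₂ t) (Two.end₂ t)
  ... | inj₁ f≡e = contradiction f≡e (Two.differ t)
  ... | inj₂ f≡h = f≡h

  multi⇒many : ∀ {x} → Multi D x → Many x
  multi⇒many (e , f , e∈ , xe , f∈ , xf , f≢e) g with e ≟ g
  ... | no e≢g = e , e∈ , xe , e≢g
  ... | yes refl = f , f∈ , xf , f≢e

  -- The obstruction at `u` to dropping `e` from `D`: the other `D`-edge `f` at `u` would keep no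
  -- neighbour in `D`.
  LeafBeyond : Fin n → Fin m → Set
  LeafBeyond u e = ∃[ f ] ∃[ y ] (Two u e f × Joins f u y × Leaf y f)

  leafBeyond? : ∀ u e → Dec (LeafBeyond u e)
  leafBeyond? u e = any? λ f → any? λ y → two? u e f ×-dec (joins? f u y ×-dec leaf? y f)

  -- Finds a substitute for `e` as dominator of `g`. With three `D`-edges at `u`, one differs from
  -- `e` and `g`. With two, the other one serves unless it is `g` itself; then the far end of `g` is
  -- no leaf and has a further `D`-edge.
  detour : ∀ {e u g} → e ∈ D → u at e → Many u → ¬ LeafBeyond u e → g ≢ e → u at g →
    ∃[ d ] (d ∈ D × d ≢ e × InN G g d)
  detour {e} {u} {g} e∈ ue many ¬lb g≢e ug with degree-of u
  ... | untouched cold = contradiction (e , e∈ , ue) cold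
  ... | one f l = contradiction many (leaf-not-many l)
  ... | several t = let d , d∈ , ud , d≢e , d≢g = t e g in d , d∈ , d≢e , d≢g , u , ug , ud
  ... | couple _ _ t with two-through t e∈ ue
  ...   | f , t′ with f ≟ g
  ...     | no f≢g = f , Two.mem₂ t′ , Two.differ t′ , f≢g , u , ug , Two.end₂ t′
  ...     | yes refl with other-end ug
  ...       | y , j with leaf-or-another (Two.mem₂ t′) (right j)
  ...         | inj₁ l = contradiction (f , y , t′ , j , l) ¬lb
  ...         | inj₂ (d , d∈ , yd , d≢f) = d , d∈ , d≢e , d≢f , y , right j , yd
    where
    -- Otherwise `e` and `g` would be parallel, both joining `u` and `y`.
    d≢e : d ≢ e
    d≢e refl = g≢e (joins-unique j (joins ue yd (distinct j)))

-- Lexicographically minimal valid sets.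

module Optimality (G : Graph n m) where
  open Incidence G

  #hot : Subset m → ℕ
  #hot D = ∣ ⟦ hot? D ⟧ ∣

  #multi : Subset m → ℕ
  #multi D = ∣ ⟦ multi? D ⟧ ∣

  -- A competitor need only be no worse in the earlier measures, so an exchange argument never has
  -- to prove equality there.
  record Optimal (D : Subset m) : Set where
    field
      valid : Valid D
      smallest : ∀ D′ → Valid D′ → ∣ D ∣ ≤ ∣ D′ ∣
      least-hot : ∀ D′ → Valid D′ → ∣ D′ ∣ ≤ ∣ D ∣ → #hot D ≤ #hot D′
      least-multi : ∀ D′ → Valid D′ → ∣ D′ ∣ ≤ ∣ D ∣ → #hot D′ ≤ #hot D → #multi D ≤ #multi D′

  -- Three successive minimisations, each confined to the valid sets no worse than the previous
  -- optima in the earlier measures.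
  optimal-exists : ∀ D → Valid D → ∃[ D′ ] Optimal D′
  optimal-exists D v =
    let D₁ , v₁ , min₁ = minimizer valid? ∣_∣ D v
        D₂ , (v₂ , s₂) , min₂ = minimizer (λ E → valid? E ×-dec (∣ E ∣ ≤? ∣ D₁ ∣)) #hot D₁ (v₁ , ≤-refl)
        D₃ , (v₃ , s₃ , h₃) , min₃ =
          minimizer (λ E → valid? E ×-dec ((∣ E ∣ ≤? ∣ D₁ ∣) ×-dec (#hot E ≤? #hot D₂))) #multi D₂ (v₂ , s₂ , ≤-refl)
    in D₃ , record
      { valid = v₃
      ; smallest = λ E vE → ≤-trans s₃ (min₁ E vE)
      ; least-hot = λ E vE sE → ≤-trans h₃ (min₂ E (vE , ≤-trans sE s₃))
      ; least-multi = λ E vE sE hE → min₃ E (vE , ≤-trans sE s₃ , ≤-trans hE h₃)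
      }

-- Local structure forced by optimality.

module Extremal (G : Graph n m) (D : Subset m) (optimal : Optimality.Optimal G D) where
  open Incidence G
  open Degrees G D
  open Optimality G
  open Optimal optimal

  dominating : Dominating D
  dominating = proj₁ valid

  packed : Packed D
  packed = proj₂ valid

  -- Without an obstruction at either end, `e` could be dropped: `detour` dominates the edges at
  -- both ends anew, and both ends keep another `D`-edge, so no vertex turns cold.
  connector : ∀ {e u v} → e ∈ D → Joins e u v → Many u → Many v → LeafBeyond u e ⊎ LeafBeyond v e
  connector {e} {u} {v} e∈ j mu mv with leafBeyond? u e | leafBeyond? v e
  ... | yes lu | _ = inj₁ lu
  ... | _ | yes lv = inj₂ lv
  ... | no ¬lu | no ¬lv = contradiction (smallest D⁻ (dom⁻ , packed⁻)) (<⇒≱ (∣without∣< D e e∈))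
    where
    D⁻ = D without e
    reroute : ∀ g w → w at e → w at g → g ≢ e → ∃[ d ] (d ∈ D × d ≢ e × InN G g d)
    reroute g w we wg g≢e with end-of j we
    ... | inj₁ refl = detour e∈ (left j) mu ¬lu g≢e wg
    ... | inj₂ refl = detour e∈ (right j) mv ¬lv g≢e wg
    dom⁻ : Dominating D⁻
    dom⁻ g with dominating g
    ... | d , d∈ , adj@(d≢g , w , wg , wd) with d ≟ e
    ...   | no d≢e = d , ∈-without⁺ D e d∈ d≢e , adj
    ...   | yes refl = let d′ , d′∈ , d′≢e , adj′ = reroute g w wd wg (≢-sym d≢g)
                       in d′ , ∈-without⁺ D e d′∈ d′≢e , adj′
    hot⁻ : ∀ w → Hot D w → Hot D⁻ w
    hot⁻ w (d , d∈ , wd) with d ≟ e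
    ... | no d≢e = d , ∈-without⁺ D e d∈ d≢e , wd
    ... | yes refl with end-of j wd
    ...   | inj₁ refl = let f , f∈ , uf , f≢e = mu e in f , ∈-without⁺ D e f∈ f≢e , uf
    ...   | inj₂ refl = let f , f∈ , vf , f≢e = mv e in f , ∈-without⁺ D e f∈ f≢e , vf
    packed⁻ : Packed D⁻
    packed⁻ u w w′ (j , cold) (j′ , cold′) = packed u w w′ (j , cold ∘ hot⁻ w) (j′ , cold′ ∘ hot⁻ w′)

  -- The edge `e` must itself be dominated, and `x` has no other edge of `D`.
  beside-leaf : ∀ {x v e} → Leaf x e → Joins e x v → ∃[ f ] (f ∈ D × v at f × f ≢ e)
  beside-leaf {e = e} l j with dominating e
  ... | d , d∈ , d≢e , w , we , wd with end-of j we
  ...   | inj₁ refl = contradiction (Leaf.only l d d∈ wd) d≢e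
  ...   | inj₂ refl = d , d∈ , wd , d≢e

  beside-leaf-many : ∀ {x v e} → Leaf x e → Joins e x v → Many v
  beside-leaf-many {e = e} l j = let f , f∈ , vf , f≢e = beside-leaf l j in
    multi⇒many (e , f , Leaf.mem l , right j , f∈ , vf , f≢e)

  NextToNear : Fin n → Set
  NextToNear x = ∃[ g ] ∃[ z ] (Joins g x z × Near D z)

  -- Outside the three cases `e` could be dropped. Only `x` turns cold. The other edges at `x` are
  -- dominated at their far ends, which are hot as `x` is not near, and packing could fail only at a
  -- neighbour of `x` that was near already.
  pendant : ∀ {e x v} → Leaf x e → Joins e x v → LeafBeyond v e ⊎ Near D x ⊎ NextToNear x
  pendant {e} {x} {v} l j
    with leafBeyond? v e | near? D x | any? (λ g → any? λ z → joins? g x z ×-dec near? D z)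
  ... | yes lb | _ | _ = inj₁ lb
  ... | _ | yes nx | _ = inj₂ (inj₁ nx)
  ... | _ | _ | yes nn = inj₂ (inj₂ nn)
  ... | no ¬lb | no ¬nx | no ¬nn = contradiction (smallest D⁻ (dom⁻ , packed⁻)) (<⇒≱ (∣without∣< D e e∈))
    where
    D⁻ = D without e
    e∈ = Leaf.mem l
    mv = beside-leaf-many l j
    reroute : ∀ g w → w at e → w at g → g ≢ e → ∃[ d ] (d ∈ D × d ≢ e × InN G g d)
    reroute g w we wg g≢e with end-of j we
    ... | inj₂ refl = detour e∈ (right j) mv ¬lb g≢e wg
    ... | inj₁ refl with other-end wg
    ...   | z , k with hot? D z
    ...     | no cold = contradiction (z , (g , k) , cold) ¬nx
    ...     | yes (d , d∈ , zd) = d , d∈ , d≢e , d≢g , z , right k , zd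
      where
      d≢g : d ≢ g
      d≢g refl = g≢e (Leaf.only l g d∈ wg)
      d≢e : d ≢ e
      d≢e refl = g≢e (joins-unique k (joins we zd (distinct k)))
    dom⁻ : Dominating D⁻
    dom⁻ g with dominating g
    ... | d , d∈ , adj@(d≢g , w , wg , wd) with d ≟ e
    ...   | no d≢e = d , ∈-without⁺ D e d∈ d≢e , adj
    ...   | yes refl = let d′ , d′∈ , d′≢e , adj′ = reroute g w wd wg (≢-sym d≢g)
                       in d′ , ∈-without⁺ D e d′∈ d′≢e , adj′
    hot⁻ : ∀ w → w ≢ x → Hot D w → Hot D⁻ w
    hot⁻ w w≢x (d , d∈ , wd) with d ≟ e
    ... | no d≢e = d , ∈-without⁺ D e d∈ d≢e , wd
    ... | yes refl with far-end j wd w≢x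
    ...   | refl = let f , f∈ , vf , f≢e = mv e in f , ∈-without⁺ D e f∈ f≢e , vf
    packed⁻ : Packed D⁻
    packed⁻ u w w′ ((g , k) , cold) ((g′ , k′) , cold′) with w ≟ x | w′ ≟ x
    ... | yes refl | yes refl = refl
    -- One of the two cold vertices is the newly cold `x`; the other makes `u` near already in `D`.
    ... | yes refl | no w′≢x = contradiction (g , u , flip k , w′ , (g′ , k′) , cold′ ∘ hot⁻ w′ w′≢x) ¬nn
    ... | no w≢x | yes refl = contradiction (g′ , u , flip k′ , w , (g , k) , cold ∘ hot⁻ w w≢x) ¬nn
    ... | no w≢x | no w′≢x =
      packed u w w′ ((g , k) , cold ∘ hot⁻ w w≢x) ((g′ , k′) , cold′ ∘ hot⁻ w′ w′≢x)

  -- A component that is a path a-b-c-d with chord bd could be replaced by the star at b,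
  -- which has fewer vertices of degree at least two.
  no-chorded-path : ∀ {a b c d p q r g} → Two b p q → Joins p b a → Joins q b c → Two c q r →
    Joins r c d → Leaf d r → Joins g b d → g ∉ D → ⊥
  no-chorded-path {a} {b} {c} {d} {p} {q} {r} {g} tb jp jq tc jr ld jg g∉ =
    contradiction (least-multi D′ (dom′ , packed′) (∣swap∣≤ D r g r∈) fewer-hot) (<⇒≱ fewer-multi)
    where
    D′ = swap D r g
    p∈ = Two.mem₁ tb
    q∈ = Two.mem₂ tb
    r∈ = Two.mem₂ tc
    p≢r : p ≢ r
    p≢r refl = [ distinct jq , distinct jg ]′ (end-of jr (left jp))
    p∈′ : p ∈ D′
    p∈′ = ∈-swap⁺ D r g p∈ p≢r
    q∈′ : q ∈ D′
    q∈′ = ∈-swap⁺ D r g q∈ (≢-sym (Two.differ tc))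
    g∈′ : g ∈ D′
    g∈′ = ∈-swap-new D r g
    reroute : ∀ e w → w at r → w at e → e ≢ r → ∃[ f ] (f ∈ D′ × InN G e f)
    reroute e w wr we e≢r with end-of jr wr
    -- Edges at `c` are dominated by `q` and edges at `d` by `g`; `q` and `g` themselves by `p` at
    -- `b`.
    ... | inj₁ refl with e ≟ q
    ...   | yes refl = p , p∈′ , ≢-sym (Two.differ tb) , b , left jq , left jp
    ...   | no e≢q = q , q∈′ , ≢-sym e≢q , c , we , right jq
    reroute e w wr we e≢r | inj₂ refl with e ≟ g
    ...   | yes refl = p , p∈′ , (λ { refl → g∉ p∈ }) , b , left jg , left jp
    ...   | no e≢g = g , g∈′ , ≢-sym e≢g , d , we , right jg
    dom′ : Dominating D′
    dom′ e with dominating e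
    ... | f , f∈ , adj@(f≢e , w , we , wf) with f ≟ r
    ...   | no f≢r = f , ∈-swap⁺ D r g f∈ f≢r , adj
    ...   | yes refl = reroute e w wf we (≢-sym f≢e)
    hot′ : ∀ w → Hot D w → Hot D′ w
    hot′ w (f , f∈ , wf) with f ≟ r
    ... | no f≢r = f , ∈-swap⁺ D r g f∈ f≢r , wf
    ... | yes refl with end-of jr wf
    ...   | inj₁ refl = q , q∈′ , right jq
    ...   | inj₂ refl = g , g∈′ , right jg
    packed′ : Packed D′
    packed′ u w w′ (k , cold) (k′ , cold′) = packed u w w′ (k , cold ∘ hot′ w) (k′ , cold′ ∘ hot′ w′)
    hot-old : ∀ {w} → Hot D′ w → Hot D w
    hot-old (f , f∈ , wf) with ∈-swap⁻ D r g f∈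
    ... | inj₁ (f∈D , _) = f , f∈D , wf
    ... | inj₂ refl with end-of jg wf
    ...   | inj₁ refl = p , p∈ , left jp
    ...   | inj₂ refl = r , r∈ , right jr
    fewer-hot : #hot D′ ≤ #hot D
    fewer-hot = p⊆q⇒∣p∣≤∣q∣ (∈⟦⟧⁺ (hot? D) ∘ hot-old ∘ ∈⟦⟧⁻ (hot? D′))
    -- The new edge `g` raises no vertex to degree two: `b` already has `p` and `q`, and the leaf
    -- `d` trades `r` for `g`.
    via-g : ∀ {w f} → w at g → f ∈ D → f ≢ r → w at f → Multi D w
    via-g wg f∈ f≢r wf with end-of jg wg
    ... | inj₁ refl = p , q , p∈ , left jp , q∈ , left jq , Two.differ tb
    ... | inj₂ refl = contradiction (Leaf.only ld _ f∈ wf) f≢r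
    multi-old : ∀ {w} → Multi D′ w → Multi D w
    multi-old (e , f , e∈ , we , f∈ , wf , f≢e) with ∈-swap⁻ D r g e∈ | ∈-swap⁻ D r g f∈
    ... | inj₁ (e∈D , _) | inj₁ (f∈D , _) = e , f , e∈D , we , f∈D , wf , f≢e
    ... | inj₁ (e∈D , e≢r) | inj₂ refl = via-g wf e∈D e≢r we
    ... | inj₂ refl | inj₁ (f∈D , f≢r) = via-g we f∈D f≢r wf
    ... | inj₂ refl | inj₂ refl = contradiction refl f≢e
    at-c : ∀ {f} → f ∈ D′ → c at f → f ≡ q
    at-c f∈ cf with ∈-swap⁻ D r g f∈
    ... | inj₁ (f∈D , f≢r) = [ (λ eq → eq) , (λ eq → contradiction eq f≢r) ]′ (Two.only tc _ f∈D cf)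
    ... | inj₂ refl = contradiction cf (avoids jg (≢-sym (distinct jq)) (distinct jr))
    fewer-multi : #multi D′ < #multi D
    fewer-multi = p⊂q⇒∣p∣<∣q∣
      ( ∈⟦⟧⁺ (multi? D) ∘ multi-old ∘ ∈⟦⟧⁻ (multi? D′)
      , c
      , ∈⟦⟧⁺ (multi? D) (q , r , q∈ , right jq , r∈ , left jr , Two.differ tc)
      , λ c∈ → let e , f , e∈ , ce , f∈ , cf , f≢e = ∈⟦⟧⁻ (multi? D′) c∈
               in f≢e (trans (at-c f∈ cf) (sym (at-c e∈ ce))) )

  record Cherry (x v y : Fin n) (p q : Fin m) : Set where
    constructor cherry
    field
      middle : Two v p q
      joins₁ : Joins p v x
      joins₂ : Joins q v y
      leaf₁ : Leaf x p
      leaf₂ : Leaf y q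

  cherry? : ∀ x v y p q → Dec (Cherry x v y p q)
  cherry? x v y p q = map′ (λ (a , b , c , d , e) → cherry a b c d e) (λ (cherry a b c d e) → a , b , c , d , e)
    (two? v p q ×-dec (joins? p v x ×-dec (joins? q v y ×-dec (leaf? x p ×-dec leaf? y q))))

  cherry-flip : ∀ {x v y p q} → Cherry x v y p q → Cherry y v x q p
  cherry-flip (cherry a b c d e) = cherry (two-swap a) c b e d

  x≢y : ∀ {x v y p q} → Cherry x v y p q → x ≢ y
  x≢y c refl = Two.differ (Cherry.middle c) (Leaf.only (Cherry.leaf₁ c) _ (Two.mem₂ (Cherry.middle c)) (right (Cherry.joins₂ c)))

  -- A cherry x-v-y whose only other edge xz leaves it at x could be traded for the path v-x-z,
  -- after which y is cold.
  no-dangling-cherry : ∀ {x v y z p q g} → Cherry x v y p q → Joins g x z → Hot D z → g ∉ D →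
    z ≢ y → (∀ f → v at f → f ≡ p ⊎ f ≡ q) → (∀ f → y at f → f ≡ q) → ⊥
  no-dangling-cherry {x} {v} {y} {z} {p} {q} {g} ch@(cherry tv jp jq lx ly) jg (h , h∈ , zh) g∉ z≢y at-v at-y =
    contradiction (least-hot D′ (dom′ , packed′) (∣swap∣≤ D q g q∈)) (<⇒≱ fewer-hot)
    where
    D′ = swap D q g
    p∈ = Two.mem₁ tv
    q∈ = Two.mem₂ tv
    p∈′ : p ∈ D′
    p∈′ = ∈-swap⁺ D q g p∈ (≢-sym (Two.differ tv))
    g∈′ : g ∈ D′
    g∈′ = ∈-swap-new D q g
    reroute : ∀ e w → w at q → w at e → e ≢ q → ∃[ f ] (f ∈ D′ × InN G e f)
    reroute e w wq we e≢q with end-of jq wq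
    ... | inj₂ refl = contradiction (at-y e we) e≢q
    ... | inj₁ refl with at-v e we
    ...   | inj₂ e≡q = contradiction e≡q e≢q
    -- The only other edge meeting `q` is `p`, which now meets `g` at `x`.
    ...   | inj₁ refl = g , g∈′ , (λ { refl → g∉ p∈ }) , x , right jp , left jg
    dom′ : Dominating D′
    dom′ e with dominating e
    ... | f , f∈ , adj@(f≢e , w , we , wf) with f ≟ q
    ...   | no f≢q = f , ∈-swap⁺ D q g f∈ f≢q , adj
    ...   | yes refl = reroute e w wf we (≢-sym f≢e)
    hot′ : ∀ w → w ≢ y → Hot D w → Hot D′ w
    hot′ w w≢y (f , f∈ , wf) with f ≟ q
    ... | no f≢q = f , ∈-swap⁺ D q g f∈ f≢q , wf
    ... | yes refl with far-end (flip jq) wf w≢y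
    ...   | refl = p , p∈′ , left jp
    -- The newly cold `y` has no neighbour but `v`, whose only other neighbour `x` stays hot through
    -- `p`.
    only-y : ∀ u w → ColdNbr D′ u y → ColdNbr D′ u w → w ≡ y
    only-y u w ((f , k) , _) ((f′ , k′) , cold) with at-y f (right k)
    ... | refl with far-end (flip jq) (left k) (distinct k)
    ...   | refl with at-v f′ (left k′)
    ...     | inj₂ refl = joins-cancel jq k′
    ...     | inj₁ refl with joins-cancel jp k′
    ...       | refl = contradiction (p , p∈′ , right jp) cold
    packed′ : Packed D′
    packed′ u w w′ k@(j , cold) k′@(j′ , cold′) with w ≟ y | w′ ≟ y
    ... | yes refl | _ = sym (only-y u w′ k k′)
    ... | _ | yes refl = only-y u w k′ k
    ... | no w≢y | no w′≢y = packed u w w′ (j , cold ∘ hot′ w w≢y) (j′ , cold′ ∘ hot′ w′ w′≢y)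
    hot-old : ∀ {w} → Hot D′ w → Hot D w
    hot-old (f , f∈ , wf) with ∈-swap⁻ D q g f∈
    ... | inj₁ (f∈D , _) = f , f∈D , wf
    ... | inj₂ refl with end-of jg wf
    ...   | inj₁ refl = p , p∈ , right jp
    ...   | inj₂ refl = h , h∈ , zh
    y-cold : ¬ Hot D′ y
    y-cold (f , f∈ , yf) with ∈-swap⁻ D q g f∈
    ... | inj₁ (_ , f≢q) = f≢q (at-y f yf)
    ... | inj₂ refl = avoids jg (≢-sym (x≢y ch)) (≢-sym z≢y) yf
    fewer-hot : #hot D′ < #hot D
    fewer-hot = p⊂q⇒∣p∣<∣q∣
      ( ∈⟦⟧⁺ (hot? D) ∘ hot-old ∘ ∈⟦⟧⁻ (hot? D′)
      , y
      , ∈⟦⟧⁺ (hot? D) (q , q∈ , right jq)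
      , y-cold ∘ ∈⟦⟧⁻ (hot? D′) )

-- Repair of cherries, and location by the repaired set.

module Repair (G : Graph n m) (D : Subset m) (optimal : Optimality.Optimal G D) where
  open Graph G using (end₁; end₂)
  open Incidence G
  open Degrees G D
  open Extremal G D optimal

  Repaired : Fin n → Fin m → Set
  Repaired v a = ∃[ x ] ∃[ y ] ∃[ p ] ∃[ q ] (Cherry x v y p q × Joins a x y × Near D v)

  repaired? : ∀ v a → Dec (Repaired v a)
  repaired? v a = any? λ x → any? λ y → any? λ p → any? λ q →
    cherry? x v y p q ×-dec (joins? a x y ×-dec near? D v)

  Added : Fin m → Set
  Added a = ∃[ v ] Repaired v a

  member? : Decidable (λ e → e ∈ D ⊎ Added e)
  member? e = (e ∈? D) ⊎-dec any? (λ v → repaired? v e)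

  D⁺ : Subset m
  D⁺ = ⟦ member? ⟧

  Free : Fin m → Set
  Free e = e ∉ D × ¬ Added e

  free : ∀ {e} → e ∉ D⁺ → Free e
  free e∉ = e∉ ∘ ∈⟦⟧⁺ member? ∘ inj₁ , e∉ ∘ ∈⟦⟧⁺ member? ∘ inj₂

  free⇒∉ : ∀ {e} → Free e → e ∉ D⁺
  free⇒∉ (e∉ , ¬a) e∈ = [ e∉ , ¬a ]′ (∈⟦⟧⁻ member? e∈)

  -- One half of having equal `D`-neighbourhoods. Edges outside `D⁺` are told apart by `D` alone,
  -- which is stronger than by `D⁺`.
  Meets : Fin m → Fin m → Set
  Meets e f = ∀ g → g ∈ D → InN G e g → InN G f g

  -- By simplicity `g` would be the only `D`-edge at its two ends, hence undominated.
  no-lone : ∀ {g s t} → g ∈ D → Joins g s t → (∀ d → d ∈ D → s at d → Joins d s t) →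
    (∀ d → d ∈ D → t at d → Joins d t s) → ⊥
  no-lone {g} g∈ j at-s at-t with dominating g
  ... | d , d∈ , d≢g , w , wg , wd with end-of j wg
  ...   | inj₁ refl = d≢g (joins-unique (at-s d d∈ wd) j)
  ...   | inj₂ refl = d≢g (joins-unique (at-t d d∈ wd) (flip j))

  -- Such a `d` meets `e`, hence also `f`. It cannot do so at `u`, where it would coincide with `e`,
  -- so it does so at `t`.
  only-across : ∀ {e f u s t} → e ∉ D → Joins e u s → Joins f u t → s ≢ t → Meets e f →
    ∀ d → d ∈ D → s at d → Joins d s t
  only-across {e} {u = u} {s} e∉ je jf s≢t meets d d∈ sd
    with meets d d∈ ((λ { refl → e∉ d∈ }) , s , right je , sd)
  ... | _ , w , wf , wd with end-of jf wf
  ...   | inj₁ refl = contradiction (subst (_∈ D) (joins-unique (joins wd sd (distinct je)) je) d∈) e∉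
  ...   | inj₂ refl = joins sd wd s≢t

  -- If `s` and `t` are both cold, packing identifies them. Otherwise every `D`-edge at `s` or `t`
  -- joins the two, which `no-lone` excludes.
  located-sharing : ∀ {e f u s t} → e ≢ f → e ∉ D → f ∉ D → Joins e u s → Joins f u t →
    Meets e f → Meets f e → ⊥
  located-sharing {e} {f} {u} {s} {t} e≢f e∉ f∉ je jf ef fe with hot? D s | hot? D t
  ... | no cs | no ct = s≢t (packed u s t ((e , je) , cs) ((f , jf) , ct))
    where
    s≢t : s ≢ t
    s≢t refl = e≢f (joins-unique je jf)
  ... | yes (g , g∈ , sg) | _ = no-lone g∈ (at-s g g∈ sg) at-s at-t
    where
    s≢t : s ≢ t
    s≢t refl = e≢f (joins-unique je jf)
    at-s = only-across e∉ je jf s≢t ef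
    at-t = only-across f∉ jf je (≢-sym s≢t) fe
  ... | _ | yes (g , g∈ , tg) = no-lone g∈ (at-t g g∈ tg) at-t at-s
    where
    s≢t : s ≢ t
    s≢t refl = e≢f (joins-unique je jf)
    at-s = only-across e∉ je jf s≢t ef
    at-t = only-across f∉ jf je (≢-sym s≢t) fe

  -- Two disjoint free edges with the same `D`-neighbours. All `D`-edges at the four vertices then
  -- cross from one edge to the other, so they lie on the 4-cycle `u`-`x`-`v`-`y`.
  record Square (e f : Fin m) (u v x y : Fin n) : Set where
    constructor square
    field
      side₁ : Joins e u v
      side₂ : Joins f x y
      free₁ : Free e
      free₂ : Free f
      meets₁ : Meets e f
      meets₂ : Meets f e
      u≢x : u ≢ x
      u≢y : u ≢ y
      v≢x : v ≢ x
      v≢y : v ≢ y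

  turn₁ : ∀ {e f u v x y} → Square e f u v x y → Square e f v u x y
  turn₁ (square a b c d e f p q r s) = square (flip a) b c d e f r s p q

  turn₂ : ∀ {e f u v x y} → Square e f u v x y → Square e f u v y x
  turn₂ (square a b c d e f p q r s) = square a (flip b) c d e f q p s r

  transpose : ∀ {e f u v x y} → Square e f u v x y → Square f e x y u v
  transpose (square a b c d e f p q r s) = square b a d c f e (≢-sym p) (≢-sym r) (≢-sym q) (≢-sym s)

  cross : ∀ {e f u v x y g} → Square e f u v x y → g ∈ D → u at g → Joins g u x ⊎ Joins g u y
  cross {u = u} {g = g} (square je jf (e∉ , _) _ ef _ u≢x u≢y _ _) g∈ ug
    with ef g g∈ ((λ { refl → e∉ g∈ }) , u , left je , ug)
  ... | _ , w , wf , wg with end-of jf wf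
  ...   | inj₁ refl = inj₁ (joins ug wg u≢x)
  ...   | inj₂ refl = inj₂ (joins ug wg u≢y)

  cross-only : ∀ {e f u v x y a b g} → Square e f u v x y → Joins a u x → Joins b u y →
    g ∈ D → u at g → g ≡ a ⊎ g ≡ b
  cross-only sq ja jb g∈ ug with cross sq g∈ ug
  ... | inj₁ j = inj₁ (joins-unique j ja)
  ... | inj₂ j = inj₂ (joins-unique j jb)

  cross-two : ∀ {e f u v x y a b} → Square e f u v x y → a ∈ D → b ∈ D → Joins a u x → Joins b u y → Two u a b
  cross-two {a = a} {b} sq a∈ b∈ ja jb = two a∈ b∈ (left ja) (left jb) b≢a λ g → cross-only sq ja jb
    where
    b≢a : b ≢ a
    b≢a refl = distinct (Square.side₂ sq) (joins-cancel jb ja)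

  cross-leaf : ∀ {e f u v x y a} → Square e f u v x y → a ∈ D → Joins a u x →
    ¬ (∃[ b ] (b ∈ D × Joins b u y)) → Leaf u a
  cross-leaf {a = a} sq a∈ ja none = leaf a∈ (left ja) only
    where
    only : ∀ g → g ∈ D → _ at g → g ≡ a
    only g g∈ ug with cross sq g∈ ug
    ... | inj₁ j = joins-unique j ja
    ... | inj₂ j = contradiction (g , g∈ , j) none

  -- Three crossing edges form the path `y`-`u`-`x`-`v`, of which `e` is a chord.
  no-path : ∀ {e f u v x y a b c} → Square e f u v x y → a ∈ D → b ∈ D → c ∈ D →
    Joins a u x → Joins b u y → Joins c v x → ¬ (∃[ d ] (d ∈ D × Joins d v y)) → ⊥
  no-path sq a∈ b∈ c∈ ja jb jc none = no-chorded-path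
    (two-swap (cross-two sq a∈ b∈ ja jb)) jb ja
    (cross-two (transpose sq) a∈ c∈ (flip ja) (flip jc)) (flip jc)
    (cross-leaf (turn₁ sq) c∈ jc none) (Square.side₁ sq) (proj₁ (Square.free₁ sq))

  -- Here `connector`, applied to `a`, demands that `y` or `v` be a leaf, but `d` is a second
  -- `D`-edge at both.
  no-cycle : ∀ {e f u v x y a b c d} → Square e f u v x y → a ∈ D → b ∈ D → c ∈ D → d ∈ D →
    Joins a u x → Joins b u y → Joins c v x → Joins d v y → ⊥
  no-cycle {d = d} sq a∈ b∈ c∈ d∈ ja jb jc jd =
    [ beyond tu jb (λ { refl → u≢v (joins-cancel (flip jd) (flip jb)) }) (right jd)
    , beyond tx (flip jc) (λ { refl → x≢y′ (joins-cancel jd jc) }) (left jd) ]′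
    (connector a∈ ja (two⇒many tu) (two⇒many tx))
    where
    u≢v = distinct (Square.side₁ sq)
    x≢y′ = distinct (Square.side₂ sq)
    tu = cross-two sq a∈ b∈ ja jb
    tx = cross-two (transpose sq) a∈ c∈ (flip ja) (flip jc)
    beyond : ∀ {w z a b} → Two w a b → Joins b w z → d ≢ b → z at d → LeafBeyond w a → ⊥
    beyond t j d≢b zd (f , z′ , t′ , j′ , l) with two-cancel t t′
    ... | refl with joins-cancel j j′
    ...   | refl = d≢b (Leaf.only l d d∈ zd)

  -- With a third crossing edge, `no-cycle` or `no-path` applies. Otherwise `x`-`u`-`y` is a cherry
  -- with base `f`, and `v` is cold and makes `u` near, so the repair has put `f` into `D⁺`.
  no-fork : ∀ {e f u v x y a b} → Square e f u v x y → a ∈ D → b ∈ D → Joins a u x → Joins b u y → ⊥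
  no-fork {e} {f} {u} {v} {x} {y} {a} {b} sq a∈ b∈ ja jb
    with any? (λ c → (c ∈? D) ×-dec joins? c v x) | any? (λ d → (d ∈? D) ×-dec joins? d v y)
  ... | yes (c , c∈ , jc) | yes (d , d∈ , jd) = no-cycle sq a∈ b∈ c∈ d∈ ja jb jc jd
  ... | yes (c , c∈ , jc) | no none = no-path sq a∈ b∈ c∈ ja jb jc none
  ... | no none | yes (d , d∈ , jd) = no-path (turn₂ sq) b∈ a∈ d∈ jb ja jd none
  ... | no noc | no nod = proj₂ (Square.free₂ sq)
    (u , x , y , a , b
    , cherry (cross-two sq a∈ b∈ ja jb) ja jb
        (cross-leaf (transpose sq) a∈ (flip ja) λ (c , c∈ , j) → noc (c , c∈ , flip j))
        (cross-leaf (transpose (turn₂ sq)) b∈ (flip jb) λ (d , d∈ , j) → nod (d , d∈ , flip j))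
    , Square.side₂ sq
    , v , (e , Square.side₁ sq) , cold)
    where
    cold : ¬ Hot D v
    cold (g , g∈ , vg) with cross (turn₁ sq) g∈ vg
    ... | inj₁ j = noc (g , g∈ , j)
    ... | inj₂ j = nod (g , g∈ , j)

  -- Whatever dominates `a` in `D` is a second crossing edge sharing an end with it, which gives a
  -- fork.
  no-crossing : ∀ {e f u v x y a} → Square e f u v x y → a ∈ D → Joins a u x → ⊥
  no-crossing {a = a} sq a∈ ja with dominating a
  ... | b , b∈ , b≢a , w , wa , wb with end-of ja wa
  ...   | inj₁ refl = [ (λ j → b≢a (joins-unique j ja)) , no-fork sq a∈ b∈ ja ]′ (cross sq b∈ wb)
  ...   | inj₂ refl = [ (λ j → b≢a (joins-unique j (flip ja))) , no-fork (transpose sq) a∈ b∈ (flip ja) ]′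
                        (cross (transpose sq) b∈ wb)

  no-square : ∀ {e f u v x y} → Square e f u v x y → ⊥
  no-square {e} sq with dominating e
  ... | d , d∈ , _ , w , we , wd with end-of (Square.side₁ sq) we
  ...   | inj₁ refl = [ no-crossing sq d∈ , no-crossing (turn₂ sq) d∈ ]′ (cross sq d∈ wd)
  ...   | inj₂ refl = [ no-crossing (turn₁ sq) d∈ , no-crossing (turn₂ (turn₁ sq)) d∈ ]′ (cross (turn₁ sq) d∈ wd)

  located : ∀ e f → e ≢ f → Free e → Free f → Meets e f → Meets f e → ⊥
  located e f e≢f fe@(e∉ , _) ff@(f∉ , _) ef fe′
    with end₁ e ≟ end₁ f | end₁ e ≟ end₂ f | end₂ e ≟ end₁ f | end₂ e ≟ end₂ f
  ... | yes eq | _ | _ | _ = located-sharing e≢f e∉ f∉ (ends e) (subst (λ w → Joins f w _) (sym eq) (ends f)) ef fe′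
  ... | _ | yes eq | _ | _ = located-sharing e≢f e∉ f∉ (ends e) (subst (λ w → Joins f w _) (sym eq) (flip (ends f))) ef fe′
  ... | _ | _ | yes eq | _ = located-sharing e≢f e∉ f∉ (flip (ends e)) (subst (λ w → Joins f w _) (sym eq) (ends f)) ef fe′
  ... | _ | _ | _ | yes eq = located-sharing e≢f e∉ f∉ (flip (ends e)) (subst (λ w → Joins f w _) (sym eq) (flip (ends f))) ef fe′
  ... | no a | no b | no c | no d = no-square (square (ends e) (ends f) fe ff ef fe′ a b c d)

  D⁺-eltd : IsELTD G D⁺
  D⁺-eltd = (λ e → let d , d∈ , adj = dominating e in d , ∈⟦⟧⁺ member? (inj₁ d∈) , adj)
          , λ e f e≢f e∉ f∉ same → located e f e≢f (free e∉) (free f∉)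
              (λ g g∈ → Equivalence.to (same g (∈⟦⟧⁺ member? (inj₁ g∈))))
              (λ g g∈ → Equivalence.from (same g (∈⟦⟧⁺ member? (inj₁ g∈))))

-- Darts, their owners and the claimants who receive them.

Dart : ℕ → Set
Dart m = Fin m × Bool

module Discharging (G : Graph n m) (D : Subset m) (optimal : Optimality.Optimal G D)
  (twin-free : EdgeTwinFree G) where
  open Graph G using (end₁; end₂)
  open Incidence G
  open Degrees G D
  open Extremal G D optimal
  open Repair G D optimal

  -- Both closed neighbourhoods would consist of the edges at `v` and the edge `xy`, if there is
  -- one.
  no-twins : ∀ {p q v x y} → Joins p v x → Joins q v y → x ≢ y →
    (∀ g → x at g → v at g ⊎ y at g) → (∀ g → y at g → v at g ⊎ x at g) → ⊥
  no-twins {p} {q} jp jq x≢y at-x at-y = twin-free p q (p≢q , inj₂ λ g → mk⇔ (half jp jq at-x g) (half jq jp at-y g))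
    where
    p≢q : p ≢ q
    p≢q refl = x≢y (joins-cancel jq jp)
    half : ∀ {p q v x y} → Joins p v x → Joins q v y → (∀ g → x at g → v at g ⊎ y at g) →
      ∀ g → InNc G p g → InNc G q g
    half {q = q} {v} {y = y} jp jq at-x g near with g ≟ q | near
    ... | yes g≡q | _ = inj₁ g≡q
    ... | no g≢q | inj₁ refl = inj₂ (g≢q , v , left jq , left jp)
    ... | no g≢q | inj₂ (_ , w , wp , wg) with end-of jp wp
    ...   | inj₁ refl = inj₂ (g≢q , v , left jq , wg)
    ...   | inj₂ refl with at-x g wg
    ...     | inj₁ vg = inj₂ (g≢q , v , left jq , vg)
    ...     | inj₂ yg = inj₂ (g≢q , y , right jq , yg)

  Escape : Fin n → Fin n → Fin n → Set
  Escape x v y = ∃[ g ] (x at g × ¬ v at g × ¬ y at g)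

  escape? : ∀ x v y → Dec (Escape x v y)
  escape? x v y = any? λ g → at? x g ×-dec (¬? (at? v g) ×-dec ¬? (at? y g))

  -- Here twin-freeness enters the payment for cherries: if neither leaf had such an edge, `p` and
  -- `q` would be twins.
  escape : ∀ {p q v x y} → Joins p v x → Joins q v y → x ≢ y → Escape x v y ⊎ Escape y v x
  escape {v = v} {x} {y} jp jq x≢y with escape? x v y | escape? y v x
  ... | yes found | _ = inj₁ found
  ... | _ | yes found = inj₂ found
  ... | no stuckˣ | no stuckʸ = ⊥-elim (no-twins jp jq x≢y (confined stuckˣ) (confined stuckʸ))
    where
    confined : ∀ {x y} → ¬ Escape x v y → ∀ g → x at g → v at g ⊎ y at g
    confined {x} {y} stuck g xg with at? v g | at? y g
    ... | yes vg | _ = inj₁ vg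
    ... | _ | yes yg = inj₂ yg
    ... | no ¬vg | no ¬yg = contradiction (g , xg , ¬vg , ¬yg) stuck

  tail : Dart m → Fin n
  tail (e , true) = end₁ e
  tail (e , false) = end₂ e

  dart-from : ∀ {e x} → x at e → ∃[ b ] x ≡ tail (e , b)
  dart-from (inj₁ eq) = true , eq
  dart-from (inj₂ eq) = false , eq

  -- Both darts of an edge to a cold vertex, or from a vertex that is not near to a near one, go to x:
  -- the near end can do without, having an edge to a cold vertex of its own.
  data Owns (x : Fin n) : Dart m → Set where
    to-cold : ∀ {e b w} → Joins e x w → ¬ Hot D w → Owns x (e , b)
    to-near : ∀ {e b z} → Joins e x z → Hot D x → ¬ Near D x → Near D z → Owns x (e , b)
    own-end : ∀ {e b z} → Joins e x z → Hot D x → ¬ Near D x → ¬ Near D z → x ≡ tail (e , b) → Owns x (e , b)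

  -- The `D`-edge dominating `e` cannot meet it at `w`.
  cold-joins-hot : ∀ {e x w} → Joins e x w → ¬ Hot D w → Hot D x
  cold-joins-hot {e} j cold with dominating e
  ... | d , d∈ , _ , u , ue , ud with end-of j ue
  ...   | inj₁ refl = d , d∈ , ud
  ...   | inj₂ refl = contradiction (d , d∈ , ud) cold

  -- A second owner would be the far end of the edge. But owners are hot, while the far end in
  -- `to-cold` is not; owners by `to-near` or `own-end` are not near, while the far end in `to-near`
  -- is; and two owners by `own-end` are both the tail.
  owner-unique : ∀ {x y δ} → Owns x δ → Owns y δ → x ≡ y
  owner-unique {x} {y} ox oy with x ≟ y
  ... | yes x≡y = x≡y
  ... | no x≢y = clash ox oy
    where
    head≡ : ∀ {e w x y} → x ≢ y → Joins e x w → y at e → y ≡ w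
    head≡ x≢y j ye = far-end j ye (≢-sym x≢y)
    clash : ∀ {δ} → Owns x δ → Owns y δ → x ≡ y
    clash (to-cold j c) (to-cold j′ c′) with head≡ x≢y j (left j′)
    ... | refl = contradiction (cold-joins-hot j′ c′) c
    clash (to-cold j c) (to-near j′ h _ _) with head≡ x≢y j (left j′)
    ... | refl = contradiction h c
    clash (to-cold j c) (own-end j′ h _ _ _) with head≡ x≢y j (left j′)
    ... | refl = contradiction h c
    clash (to-near j h _ _) (to-cold j′ c) with head≡ (≢-sym x≢y) j′ (left j)
    ... | refl = contradiction h c
    clash (own-end j h _ _ _) (to-cold j′ c) with head≡ (≢-sym x≢y) j′ (left j)
    ... | refl = contradiction h c
    clash (to-near j _ ¬nx nz) (to-near j′ _ ¬ny _) with head≡ x≢y j (left j′)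
    ... | refl = contradiction nz ¬ny
    clash (to-near j _ ¬nx nz) (own-end j′ _ ¬ny _ _) with head≡ x≢y j (left j′)
    ... | refl = contradiction nz ¬ny
    clash (own-end j _ ¬nx _ _) (to-near j′ _ ¬ny nz) with head≡ (≢-sym x≢y) j′ (left j)
    ... | refl = contradiction nz ¬nx
    clash (own-end _ _ _ _ eq) (own-end _ _ _ _ eq′) = trans eq (sym eq′)

  -- Block k x: vertex x hands the darts it owns to the claimant k.
  data Block : Fin n → Fin n → Set where
    short-leg : ∀ {x v e} → Leaf x e → Joins e x v → Three v → Block x x
    joint : ∀ {x e f} → Two x e f → Block x x
    long-leg : ∀ {x k e f g} → Leaf x e → Joins e x k → Two k f g → Block k x
    centre : ∀ {x k e} → Three x → Leaf k e → Joins e k x → (∀ g → k at g → g ≡ e) → Block k x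

  leaf-partner : ∀ {x e f v w} → Leaf x e → Leaf x f → Joins e x v → Joins f x w → w ≡ v
  leaf-partner l l′ j j′ with leaf-unique l l′
  ... | refl = joins-cancel j j′

  leaf-not-two : ∀ {x e f g} → Leaf x e → ¬ Two x f g
  leaf-not-two l t = leaf-not-many l (two⇒many t)

  leaf-not-three : ∀ {x e} → Leaf x e → ¬ Three x
  leaf-not-three l t = leaf-not-many l (three⇒many t)

  -- The `D`-degree of `x`, and at a leaf that of its `D`-neighbour, decides the constructor. Under
  -- `centre`, two claimants would be vertices of degree one in `G` with the same neighbour, so
  -- their edges would be twins.
  block-unique : ∀ {k l x} → Block k x → Block l x → k ≡ l
  block-unique (short-leg _ _ _) (short-leg _ _ _) = refl
  block-unique (short-leg l _ _) (joint t) = contradiction t (leaf-not-two l)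
  block-unique (short-leg l j t) (long-leg l′ j′ t′) with leaf-partner l l′ j j′
  ... | refl = contradiction t (two-not-three t′)
  block-unique (short-leg l _ _) (centre t _ _ _) = contradiction t (leaf-not-three l)
  block-unique (joint t) (short-leg l _ _) = contradiction t (leaf-not-two l)
  block-unique (joint _) (joint _) = refl
  block-unique (joint t) (long-leg l _ _) = contradiction t (leaf-not-two l)
  block-unique (joint t) (centre t′ _ _ _) = contradiction t′ (two-not-three t)
  block-unique (long-leg l j t) (short-leg l′ j′ t′) with leaf-partner l l′ j j′
  ... | refl = contradiction t′ (two-not-three t)
  block-unique (long-leg l _ _) (joint t) = contradiction t (leaf-not-two l)
  block-unique (long-leg l j _) (long-leg l′ j′ _) = leaf-partner l′ l j′ j
  block-unique (long-leg l _ _) (centre t _ _ _) = contradiction t (leaf-not-three l)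
  block-unique (centre t _ _ _) (short-leg l _ _) = contradiction t (leaf-not-three l)
  block-unique (centre t _ _ _) (joint t′) = contradiction t (two-not-three t′)
  block-unique (centre t _ _ _) (long-leg l _ _) = contradiction t (leaf-not-three l)
  block-unique {k} {l} (centre _ _ j only) (centre _ _ j′ only′) = decidable-stable (k ≟ l) λ k≢l →
    no-twins (flip j) (flip j′) k≢l
      (λ g kg → inj₁ (subst (_ at_) (sym (only g kg)) (right j)))
      (λ g lg → inj₁ (subst (_ at_) (sym (only′ g lg)) (right j′)))

  record Charged (k : Fin n) (δ : Dart m) : Set where
    constructor charged
    field
      {via} : Fin n
      unused : Free (proj₁ δ)
      block : Block k via
      owns : Owns via δ

  charged-unique : ∀ {k l δ} → Charged k δ → Charged l δ → k ≡ l
  charged-unique (charged _ b o) (charged _ b′ o′) with owner-unique o o′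
  ... | refl = block-unique b b′

  added-leaf : ∀ {g x} → Added g → x at g →
    ∃[ v ] ∃[ y ] ∃[ p ] ∃[ q ] (Cherry x v y p q × Joins g x y × Near D v)
  added-leaf (v , x , y , p , q , ch , j , nv) xg with end-of j xg
  ... | inj₁ refl = v , y , p , q , ch , j , nv
  ... | inj₂ refl = v , x , q , p , cherry-flip ch , flip j , nv

  added-at-leaf : ∀ {g x p v} → Added g → x at g → p ∈ D → Joins p v x →
    ∃[ y ] ∃[ q ] (Cherry x v y p q × Joins g x y × Near D v)
  added-at-leaf a xg p∈ jp with added-leaf a xg
  ... | v′ , y , p′ , q , ch , j , nv with Leaf.only (Cherry.leaf₁ ch) _ p∈ (right jp)
  ...   | refl with joins-cancel (flip jp) (flip (Cherry.joins₁ ch))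
  ...     | refl = y , q , ch , j , nv

  not-added-at-many : ∀ {g x} → Many x → x at g → ¬ Added g
  not-added-at-many many xg a with added-leaf a xg
  ... | _ , _ , _ , _ , ch , _ = leaf-not-many (Cherry.leaf₁ ch) many

  -- An edge with a cold end is free, because edges of `D` and repair edges have hot ends only.
  gift-cold : ∀ {k x e w} → Joins e x w → ¬ Hot D w → Block k x → ∀ b → Charged k (e , b)
  gift-cold {e = e} j cold bl b = charged (e∉ , not-added) bl (to-cold j cold)
    where
    e∉ : e ∉ D
    e∉ e∈ = cold (e , e∈ , right j)
    not-added : ¬ Added e
    not-added a with added-leaf a (right j)
    ... | _ , _ , p , _ , ch , _ = cold (p , Leaf.mem (Cherry.leaf₁ ch) , Leaf.end (Cherry.leaf₁ ch))

  gift-near : ∀ {k x} → Near D x → Block k x → ∃[ e ] (x at e × (∀ b → Charged k (e , b)))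
  gift-near (w , (e , j) , cold) bl = e , left j , gift-cold j cold bl

  gift-one : ∀ {k x e} → x at e → Free e → Hot D x → ¬ Near D x → Block k x → ∃[ b ] Charged k (e , b)
  gift-one xe fr hot ¬nx bl with other-end xe
  ... | z , j with near? D z | dart-from xe
  ...   | yes nz | _ = true , charged fr bl (to-near j hot ¬nx nz)
  ...   | no ¬nz | b , eq = b , charged fr bl (own-end j hot ¬nx ¬nz eq)

  -- Claims on the edges of `D⁺`.

  data Claim (k : Fin n) (a : Fin m) : Set where
    by-leaf : ∀ {v} → Leaf k a → Joins a k v → Three v → Claim k a
    by-joint : ∀ {e f x} → a ∈ D → k at a → Two k e f → Joins e k x → Leaf x e → Claim k a
    by-repair : Repaired k a → Claim k a

  claimed-leaf : ∀ {a u v} → Leaf u a → Joins a u v → ∃[ k ] Claim k a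
  claimed-leaf {a} {u} {v} l j with degree-of v
  ... | untouched cold = contradiction (a , Leaf.mem l , right j) cold
  ... | one _ l′ = contradiction (beside-leaf-many l j) (leaf-not-many l′)
  ... | several t = u , by-leaf l j t
  ... | couple _ _ t with two-through t (Leaf.mem l) (right j)
  ...   | _ , t′ = v , by-joint (Leaf.mem l) (right j) t′ (flip j) l

  -- An edge of `D` without a leaf end has, by `connector`, an end of `D`-degree two next to a leaf,
  -- and this end claims it.
  claimed : ∀ {a} → a ∈ D⁺ → ∃[ k ] Claim k a
  claimed {a} a∈⁺ with ∈⟦⟧⁻ member? a∈⁺
  ... | inj₂ (v , rep) = v , by-repair rep
  ... | inj₁ a∈ with leaf-or-another a∈ (left (ends a)) | leaf-or-another a∈ (right (ends a))
  ...   | inj₁ l | _ = claimed-leaf l (ends a)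
  ...   | _ | inj₁ l = claimed-leaf l (flip (ends a))
  ...   | inj₂ (f , f∈ , uf , f≢a) | inj₂ (g , g∈ , vg , g≢a)
    with connector a∈ (ends a) (multi⇒many (a , f , a∈ , left (ends a) , f∈ , uf , f≢a))
           (multi⇒many (a , g , a∈ , right (ends a) , g∈ , vg , g≢a))
  ...     | inj₁ (_ , _ , t , j , l) = _ , by-joint a∈ (left (ends a)) (two-swap t) j l
  ...     | inj₂ (_ , _ , t , j , l) = _ , by-joint a∈ (right (ends a)) (two-swap t) j l

  -- Payment of each claimant.

  record Supply (k : Fin n) : Set where
    constructor supply
    field
      debts : List (Fin m)
      darts : List (Dart m)
      complete : ∀ {a} → Claim k a → a ∈ˡ debts
      enough : length debts ≤ length darts
      unique : Unique darts
      all-charged : All (Charged k) darts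

  nothing-owed : ∀ {k} → (∀ {a} → ¬ Claim k a) → Supply k
  nothing-owed none = supply [] [] (λ c → contradiction c none) z≤n [] []

  pay-both : ∀ {k e p q} → (∀ {a} → Claim k a → a ≡ p ⊎ a ≡ q) → (∀ b → Charged k (e , b)) → Supply k
  pay-both {e = e} {p} {q} claims ch = supply (p ∷ q ∷ []) ((e , true) ∷ (e , false) ∷ [])
    (λ c → [ (λ eq → here eq) , (λ eq → there (here eq)) ]′ (claims c)) ≤-refl
    (((λ ()) ∷ []) ∷ [] ∷ []) (ch true ∷ ch false ∷ [])

  pay-two : ∀ {k e f b c p q} → (∀ {a} → Claim k a → a ≡ p ⊎ a ≡ q) → e ≢ f →
    Charged k (e , b) → Charged k (f , c) → Supply k
  pay-two {e = e} {f} {b} {c} {p} {q} claims e≢f ce cf = supply (p ∷ q ∷ []) ((e , b) ∷ (f , c) ∷ [])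
    (λ c → [ (λ eq → here eq) , (λ eq → there (here eq)) ]′ (claims c)) ≤-refl
    ((e≢f ∘ cong proj₁ ∷ []) ∷ [] ∷ []) (ce ∷ cf ∷ [])

  pay-three : ∀ {k e f c p q a} → (∀ {a′} → Claim k a′ → a′ ≡ p ⊎ a′ ≡ q ⊎ a′ ≡ a) → e ≢ f →
    (∀ b → Charged k (e , b)) → Charged k (f , c) → Supply k
  pay-three {e = e} {f} {c} {p} {q} {a} claims e≢f ce cf =
    supply (p ∷ q ∷ a ∷ []) ((e , true) ∷ (e , false) ∷ (f , c) ∷ [])
    (λ c → [ (λ eq → here eq) , [ (λ eq → there (here eq)) , (λ eq → there (there (here eq))) ]′ ]′ (claims c)) ≤-refl
    (((λ ()) ∷ e≢f ∘ cong proj₁ ∷ []) ∷ (e≢f ∘ cong proj₁ ∷ []) ∷ [] ∷ []) (ce true ∷ ce false ∷ cf ∷ [])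

  -- One dart is due. If `k` is near or has a second edge, it is found there. Otherwise `k` has
  -- degree one in `G`, and `pendant` leaves only the case that `v` is near; the dart then comes
  -- from `v` by `centre`.
  short-leg-supply : ∀ {k e v} → Leaf k e → Joins e k v → Three v → Supply k
  short-leg-supply {k} {e} {v} l j t = let δ , ch = gift in
    supply (e ∷ []) (δ ∷ []) owed ≤-refl ([] ∷ []) (ch ∷ [])
    where
    owed : ∀ {a} → Claim k a → a ∈ˡ e ∷ []
    owed (by-leaf l′ _ _) = here (leaf-unique l′ l)
    owed (by-joint _ _ t′ _ _) = contradiction t′ (leaf-not-two l)
    owed (by-repair (_ , _ , _ , _ , ch , _)) = contradiction (Cherry.middle ch) (leaf-not-two l)
    bl = short-leg l j t
    gift : ∃[ δ ] Charged k δ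
    gift with near? D k
    ... | yes nk = let f , _ , ch = gift-near nk bl in (f , true) , ch true
    ... | no ¬nk with any? (λ g → at? k g ×-dec ¬? (g ≟ e))
    ...   | yes (g , kg , g≢e) = let b , ch = gift-one kg (g∉ , ¬added) hot ¬nk bl in (g , b) , ch
      where
      hot : Hot D k
      hot = e , Leaf.mem l , Leaf.end l
      g∉ : g ∉ D
      g∉ g∈ = g≢e (Leaf.only l g g∈ kg)
      ¬added : ¬ Added g
      ¬added a with added-at-leaf a kg (Leaf.mem l) (flip j)
      ... | _ , _ , ch , _ = two-not-three (Cherry.middle ch) t
    ...   | no lonely with pendant l j
    ...     | inj₁ (_ , _ , t′ , _) = contradiction t (two-not-three t′)
    ...     | inj₂ (inj₁ nk) = contradiction nk ¬nk
    ...     | inj₂ (inj₂ (g , z , jg , nz)) with decidable-stable (g ≟ e) (λ g≢e → lonely (g , left jg , g≢e))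
    ...       | refl with joins-cancel j jg
    ...         | refl = let f , _ , ch = gift-near nz (centre t l j only) in (f , true) , ch true
      where
      only : ∀ f → k at f → f ≡ e
      only f kf = decidable-stable (f ≟ e) λ f≢e → lonely (f , kf , f≢e)

  cherry-leaf : ∀ {x k y p q g z} → Cherry x k y p q → g ∈ D → Joins g k z → Leaf z g
  cherry-leaf (cherry t jp jq lx ly) g∈ jg with Two.only t _ g∈ (left jg)
  ... | inj₁ refl = subst (λ w → Leaf w _) (joins-cancel jg jp) lx
  ... | inj₂ refl = subst (λ w → Leaf w _) (joins-cancel jg jq) ly

  -- Both darts of a single edge pay. As `y` is no leaf, `pendant` makes `x` near or adjacent to a
  -- near `z`. An edge to a cold vertex serves if `x` is near or `z` is `k`; otherwise `x` owns the
  -- whole edge to `z`.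
  long-leg-supply : ∀ {k p q x y} → Two k p q → Joins p k x → Leaf x p → Joins q k y → ¬ Leaf y q → Supply k
  long-leg-supply {k} {p} {q} {x} {y} t jp lx jq ¬ly = let e , ch = gift in pay-both claims ch
    where
    claims : ∀ {a} → Claim k a → a ≡ p ⊎ a ≡ q
    claims (by-leaf l _ _) = contradiction t (leaf-not-two l)
    claims (by-joint a∈ ka _ _ _) = Two.only t _ a∈ ka
    claims (by-repair (_ , _ , _ , _ , ch , _)) = contradiction (cherry-leaf ch (Two.mem₂ t) jq) ¬ly
    bl = long-leg lx (flip jp) t
    gift : ∃[ e ] (∀ b → Charged k (e , b))
    gift with near? D x | pendant lx (flip jp)
    ... | yes nx | _ = let e , _ , ch = gift-near nx bl in e , ch
    ... | _ | inj₂ (inj₁ nx) = let e , _ , ch = gift-near nx bl in e , ch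
    ... | _ | inj₁ (_ , _ , t′ , j′ , l′) with two-cancel t t′
    ...   | refl with joins-cancel jq j′
    ...     | refl = contradiction l′ ¬ly
    gift | no ¬nx | inj₂ (inj₂ (g , z , jg , nz)) with z ≟ k
    ... | yes refl = let e , _ , ch = gift-near nz (joint t) in e , ch
    ... | no z≢k = g , λ b → charged (g∉ , ¬added) bl (to-near jg (p , Two.mem₁ t , right jp) ¬nx nz)
      where
      g∉ : g ∉ D
      g∉ g∈ with Leaf.only lx g g∈ (left jg)
      ... | refl = z≢k (joins-cancel (flip jp) jg)
      ¬added : ¬ Added g
      ¬added a with added-at-leaf a (left jg) (Two.mem₁ t) jp
      ... | _ , _ , ch , _ = ¬ly (cherry-leaf ch (Two.mem₂ t) jq)

  cherry-other : ∀ {x k y y′ p q q′} → Cherry x k y p q → Cherry x k y′ p q′ → y′ ≡ y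
  cherry-other c c′ with two-cancel (Cherry.middle c) (Cherry.middle c′)
  ... | refl = joins-cancel (Cherry.joins₂ c) (Cherry.joins₂ c′)

  -- As `k` has just two `D`-edges, its cherry is unique up to exchanging the leaves.
  cherry-base : ∀ {x k y p q x′ y′ p′ q′ a} → Cherry x k y p q → Cherry x′ k y′ p′ q′ → Joins a x′ y′ → Joins a x y
  cherry-base c c′ j with Two.only (Cherry.middle c) _ (Two.mem₁ (Cherry.middle c′)) (Two.end₁ (Cherry.middle c′))
  ... | inj₁ refl with joins-cancel (Cherry.joins₁ c) (Cherry.joins₁ c′)
  ...   | refl with cherry-other c c′
  ...     | refl = j
  cherry-base c c′ j | inj₂ refl with joins-cancel (Cherry.joins₂ c) (Cherry.joins₁ c′)
  ...   | refl with cherry-other (cherry-flip c) c′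
  ...     | refl = flip j

  module _ {x k y p q} (c : Cherry x k y p q) where
    open Cherry c

    private
      hotˣ : Hot D x
      hotˣ = p , Leaf.mem leaf₁ , Leaf.end leaf₁

    escape-unadded : ∀ {g} → x at g → ¬ y at g → ¬ Added g
    escape-unadded xg ¬yg a with added-at-leaf a xg (Leaf.mem leaf₁) joins₁
    ... | _ , _ , c′ , j , _ with cherry-other c c′
    ...   | refl = ¬yg (right j)

    escape-free : ∀ {g} → x at g → ¬ k at g → ¬ y at g → Free g
    escape-free {g} xg ¬kg ¬yg = g∉ , escape-unadded xg ¬yg
      where
      g∉ : g ∉ D
      g∉ g∈ with Leaf.only leaf₁ g g∈ xg
      ... | refl = ¬kg (left joins₁)

    end-block : Block k x
    end-block = long-leg leaf₁ (flip joins₁) middle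

    touching : ¬ Near D k → ¬ Near D x → ∀ {g} → g ∉ D → x at g → ∃[ b ] Charged k (g , b)
    touching ¬nk ¬nx {g} g∉ xg = gift-one xg (g∉ , ¬added) hotˣ ¬nx end-block
      where
      ¬added : ¬ Added g
      ¬added a with added-at-leaf a xg (Leaf.mem leaf₁) joins₁
      ... | _ , _ , _ , _ , nk = ¬nk nk

    -- That the edge of the dart avoids `k` keeps it apart from the edge at `k` paying for `p` and
    -- `q`.
    extra-near : Hot D k → Near D x → ∃[ δ ] (Charged k δ × ¬ k at proj₁ δ)
    extra-near hk (w , (e , j) , cold) = (e , true) , gift-cold j cold end-block true
      , avoids j (distinct joins₁) λ { refl → cold hk }

    extra-escape : ¬ Near D x → Escape x k y → ∃[ δ ] (Charged k δ × ¬ k at proj₁ δ)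
    extra-escape ¬nx (g , xg , ¬kg , ¬yg) =
      let b , ch = gift-one xg (escape-free xg ¬kg ¬yg) hotˣ ¬nx end-block in (g , b) , ch , ¬kg

  cherry-claims : ∀ {x k y p q a} → Cherry x k y p q → Claim k a → (a ≡ p ⊎ a ≡ q) ⊎ (Joins a x y × Near D k)
  cherry-claims c (by-leaf l _ _) = contradiction (Cherry.middle c) (leaf-not-two l)
  cherry-claims c (by-joint a∈ ka _ _ _) = inj₁ (Two.only (Cherry.middle c) _ a∈ ka)
  cherry-claims c (by-repair (_ , _ , _ , _ , c′ , j , nk)) = inj₂ (cherry-base c c′ j , nk)

  -- The escaping edge `g` yields one dart, and any further edge outside `D` touching the cherry
  -- yields the other. If there is none, the cherry dangles from `g`, contrary to
  -- `no-dangling-cherry`.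
  escaping-supply : ∀ {x k y p q} → Cherry x k y p q → ¬ Near D k → ¬ Near D x → ¬ Near D y →
    Escape x k y → Supply k
  escaping-supply {x} {k} {y} {p} {q} c@(cherry t jp jq lx ly) ¬nk ¬nx ¬ny (g , xg , ¬kg , ¬yg)
    with any? (λ h → ¬? (h ≟ g) ×-dec (¬? (h ∈? D) ×-dec (at? x h ⊎-dec (at? k h ⊎-dec at? y h))))
  ... | yes (h , h≢g , h∉ , at-h) = pay-two claims (≢-sym h≢g) (proj₂ (touching c ¬nk ¬nx g∉ xg)) (proj₂ (second at-h))
    where
    g∉ = proj₁ (escape-free c xg ¬kg ¬yg)
    claims : ∀ {a} → Claim k a → a ≡ p ⊎ a ≡ q
    claims cl = [ (λ eq → eq) , (λ (_ , nk) → contradiction nk ¬nk) ]′ (cherry-claims c cl)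
    second : x at h ⊎ k at h ⊎ y at h → ∃[ b ] Charged k (h , b)
    second (inj₁ xh) = touching c ¬nk ¬nx h∉ xh
    second (inj₂ (inj₁ kh)) =
      gift-one kh (h∉ , not-added-at-many (two⇒many t) kh) (p , Two.mem₁ t , left jp) ¬nk (joint t)
    second (inj₂ (inj₂ yh)) = touching (cherry-flip c) ¬nk ¬ny h∉ yh
  ... | no rest = ⊥-elim (no-dangling-cherry c jg hot g∉ (λ { refl → ¬yg (right jg) }) at-k at-y)
    where
    g∉ = proj₁ (escape-free c xg ¬kg ¬yg)
    z = proj₁ (other-end xg)
    jg = proj₂ (other-end xg)
    hot : Hot D z
    hot = decidable-stable (hot? D z) λ cold → ¬nx (z , (g , jg) , cold)
    at-k : ∀ f → k at f → f ≡ p ⊎ f ≡ q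
    at-k f kf with f ∈? D
    ... | yes f∈ = Two.only t f f∈ kf
    ... | no f∉ = contradiction (f , (λ { refl → ¬kg kf }) , f∉ , inj₂ (inj₁ kf)) rest
    at-y : ∀ f → y at f → f ≡ q
    at-y f yf with f ∈? D
    ... | yes f∈ = Leaf.only ly f f∈ yf
    ... | no f∉ = contradiction (f , (λ { refl → ¬yg yf }) , f∉ , inj₂ (inj₂ yf)) rest

  -- The dart for the repair edge comes from a leaf of the cherry: from an edge to a cold vertex or,
  -- if neither leaf is near, from an escaping edge.
  repair-extra : ∀ {x k y p q} → Cherry x k y p q → ∃[ δ ] (Charged k δ × ¬ k at proj₁ δ)
  repair-extra {x} {k} {y} {p} c@(cherry t jp jq _ _) with near? D x | near? D y
  ... | yes nx | _ = extra-near c (p , Two.mem₁ t , left jp) nx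
  ... | _ | yes ny = extra-near (cherry-flip c) (p , Two.mem₁ t , left jp) ny
  ... | no ¬nx | no ¬ny with escape jp jq (x≢y c)
  ...   | inj₁ esc = extra-escape c ¬nx esc
  ...   | inj₂ esc = extra-escape (cherry-flip c) ¬ny esc

  -- Three darts are due only if `k` is near and `xy` is an edge; the edge from `k` to its cold
  -- neighbour then pays for `p` and `q`, and `repair-extra` for `xy`.
  cherry-supply : ∀ {x k y p q} → Cherry x k y p q → Supply k
  cherry-supply {x} {k} {y} {p} {q} c@(cherry t jp jq _ _)
    with near? D k | any? (λ a → joins? a x y)
  ... | yes nk | yes (a , ja) =
    let e , ke , ch = gift-near nk (joint t)
        δ , extra , ¬kδ = repair-extra c
    in pay-three claims (λ { refl → ¬kδ ke }) ch extra
    where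
    claims : ∀ {a′} → Claim k a′ → a′ ≡ p ⊎ a′ ≡ q ⊎ a′ ≡ a
    claims cl with cherry-claims c cl
    ... | inj₁ (inj₁ eq) = inj₁ eq
    ... | inj₁ (inj₂ eq) = inj₂ (inj₁ eq)
    ... | inj₂ (j , _) = inj₂ (inj₂ (joins-unique j ja))
  ... | yes nk | no none = let _ , _ , ch = gift-near nk (joint t) in pay-both claims ch
    where
    claims : ∀ {a} → Claim k a → a ≡ p ⊎ a ≡ q
    claims {a} cl = [ (λ eq → eq) , (λ (j , _) → contradiction (a , j) none) ]′ (cherry-claims c cl)
  ... | no ¬nk | _ = unrepaired
    where
    claims : ∀ {a} → Claim k a → a ≡ p ⊎ a ≡ q
    claims cl = [ (λ eq → eq) , (λ (_ , nk) → contradiction nk ¬nk) ]′ (cherry-claims c cl)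
    unrepaired : Supply k
    unrepaired with near? D x | near? D y
    ... | yes nx | _ = let _ , _ , ch = gift-near nx (end-block c) in pay-both claims ch
    ... | _ | yes ny = let _ , _ , ch = gift-near ny (end-block (cherry-flip c)) in pay-both claims ch
    ... | no ¬nx | no ¬ny with escape jp jq (x≢y c)
    ...   | inj₁ esc = escaping-supply c ¬nk ¬nx ¬ny esc
    ...   | inj₂ esc = escaping-supply (cherry-flip c) ¬nk ¬ny ¬nx esc

  claim-hot : ∀ {k a} → Claim k a → Hot D k
  claim-hot (by-leaf l _ _) = _ , Leaf.mem l , Leaf.end l
  claim-hot (by-joint a∈ ka _ _ _) = _ , a∈ , ka
  claim-hot (by-repair (_ , _ , _ , _ , c , _)) = _ , Two.mem₁ (Cherry.middle c) , Two.end₁ (Cherry.middle c)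

  supply-at : ∀ k → Supply k
  supply-at k with degree-of k
  ... | untouched cold = nothing-owed (cold ∘ claim-hot)
  ... | several t = nothing-owed λ
    { (by-leaf l _ _) → leaf-not-three l t
    ; (by-joint _ _ t′ _ _) → two-not-three t′ t
    ; (by-repair (_ , _ , _ , _ , c , _)) → two-not-three (Cherry.middle c) t }
  ... | one e l with other-end (Leaf.end l)
  ...   | v , j with degree-of v
  ...     | several t = short-leg-supply l j t
  ...     | untouched cold = contradiction (e , Leaf.mem l , right j) cold
  ...     | one _ l′ = contradiction (beside-leaf-many l j) (leaf-not-many l′)
  -- Here `v` has `D`-degree two and is itself the claimant of `e`.
  ...     | couple _ _ t = nothing-owed λ
    { (by-leaf l′ j′ t′) → two-not-three t (subst Three (leaf-partner l l′ j j′) t′)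
    ; (by-joint _ _ t′ _ _) → leaf-not-two l t′
    ; (by-repair (_ , _ , _ , _ , c , _)) → leaf-not-two l (Cherry.middle c) }
  supply-at k | couple p q t with other-end (Two.end₁ t) | other-end (Two.end₂ t)
  ... | x , jp | y , jq with leaf? x p | leaf? y q
  ...   | yes lx | yes ly = cherry-supply (cherry t jp jq lx ly)
  ...   | yes lx | no ¬ly = long-leg-supply t jp lx jq ¬ly
  ...   | no ¬lx | yes ly = long-leg-supply (two-swap t) jq ly jp ¬lx
  ...   | no ¬lx | no ¬ly = nothing-owed no-claim
    where
    no-leaf : ∀ {e z} → e ∈ D → Joins e k z → ¬ Leaf z e
    no-leaf e∈ je l with Two.only t _ e∈ (left je)
    ... | inj₁ refl = ¬lx (subst (λ w → Leaf w p) (joins-cancel jp je) l)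
    ... | inj₂ refl = ¬ly (subst (λ w → Leaf w q) (joins-cancel jq je) l)
    no-claim : ∀ {a} → ¬ Claim k a
    no-claim (by-leaf l _ _) = leaf-not-two l t
    no-claim (by-joint _ _ _ j l) = no-leaf (Leaf.mem l) j l
    no-claim (by-repair (_ , _ , _ , _ , c , _)) =
      no-leaf (Leaf.mem (Cherry.leaf₁ c)) (Cherry.joins₁ c) (Cherry.leaf₁ c)

  -- The final count.

  free-darts : List (Dart m)
  free-darts = map (_, true) (elements (∁ D⁺)) ++ map (_, false) (elements (∁ D⁺))

  charged⇒free : ∀ {k δ} → Charged k δ → δ ∈ˡ free-darts
  charged⇒free {δ = e , b} (charged fr _ _) = pick b
    where
    e∈ : e ∈ˡ elements (∁ D⁺)
    e∈ = ∈⇒∈elements (x∉p⇒x∈∁p (free⇒∉ fr))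
    pick : ∀ b → (e , b) ∈ˡ free-darts
    pick true = ∈-++⁺ˡ (∈-map⁺ (_, true) e∈)
    pick false = ∈-++⁺ʳ (map (_, true) (elements (∁ D⁺))) (∈-map⁺ (_, false) e∈)

  length-free-darts : length free-darts ≡ 2 * (m ∸ ∣ D⁺ ∣)
  length-free-darts = begin
    length free-darts                                 ≡⟨ length-++ (map (_, true) (elements (∁ D⁺))) ⟩
    length (map (_, true) (elements (∁ D⁺))) + length (map (_, false) (elements (∁ D⁺)))
      ≡⟨ cong₂ _+_ (one-side (_, true)) (trans (one-side (_, false)) (sym (+-identityʳ _))) ⟩
    2 * (m ∸ ∣ D⁺ ∣)                                  ∎
    where
    open ≡-Reasoning
    one-side : (f : Fin m → Dart m) → length (map f (elements (∁ D⁺))) ≡ m ∸ ∣ D⁺ ∣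
    one-side f = trans (length-map f (elements (∁ D⁺))) (trans (length-elements (∁ D⁺)) (∣∁p∣≡n∸∣p∣ D⁺))

  -- Every edge of `D⁺` is among the debts of some vertex, each vertex has at least as many darts as
  -- debts, and by `charged-unique` no dart pays two vertices.
  ∣D⁺∣≤2∣∁D⁺∣ : ∣ D⁺ ∣ ≤ 2 * (m ∸ ∣ D⁺ ∣)
  ∣D⁺∣≤2∣∁D⁺∣ = begin
    ∣ D⁺ ∣                                  ≡⟨ sym (length-elements D⁺) ⟩
    length (elements D⁺)                    ≤⟨ unique-⊆⇒length≤ (elements-unique D⁺) owed ⟩
    length (concatMap debts′ (allFin n))    ≤⟨ length-concatMap-mono darts′ debts′ (λ k → enough (supply-at k)) (allFin n) ⟩
    length (concatMap darts′ (allFin n))    ≤⟨ unique-⊆⇒length≤ distinct-darts paid ⟩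
    length free-darts                       ≡⟨ length-free-darts ⟩
    2 * (m ∸ ∣ D⁺ ∣)                        ∎
    where
    open ≤-Reasoning
    open Supply
    debts′ : Fin n → List (Fin m)
    debts′ k = debts (supply-at k)
    darts′ : Fin n → List (Dart m)
    darts′ k = darts (supply-at k)
    owed : ∀ {a} → a ∈ˡ elements D⁺ → a ∈ˡ concatMap debts′ (allFin n)
    owed a∈ = let k , cl = claimed (∈elements⇒∈ D⁺ a∈) in
      ∈-concatMap debts′ (∈-allFin k) (complete (supply-at k) cl)
    charge : ∀ {k δ} → δ ∈ˡ darts′ k → Charged k δ
    charge {k} = All.lookup (all-charged (supply-at k))
    distinct-darts : Unique (concatMap darts′ (allFin n))
    distinct-darts = unique-concatMap darts′ (λ k → unique (supply-at k))
      (λ δ∈ δ∈′ → charged-unique (charge δ∈) (charge δ∈′)) (Uniqueₚ.allFin⁺ n)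
    paid : ∀ {δ} → δ ∈ˡ concatMap darts′ (allFin n) → δ ∈ˡ free-darts
    paid δ∈ = let _ , _ , δ∈k = ∈-concatMap⇒∃ darts′ (allFin n) δ∈ in charged⇒free (charge δ∈k)

  3∣D⁺∣≤2m : 3 * ∣ D⁺ ∣ ≤ 2 * m
  3∣D⁺∣≤2m = begin
    ∣ D⁺ ∣ + 2 * ∣ D⁺ ∣                   ≤⟨ +-monoˡ-≤ (2 * ∣ D⁺ ∣) ∣D⁺∣≤2∣∁D⁺∣ ⟩
    2 * (m ∸ ∣ D⁺ ∣) + 2 * ∣ D⁺ ∣         ≡⟨ sym (*-distribˡ-+ 2 (m ∸ ∣ D⁺ ∣) ∣ D⁺ ∣) ⟩
    2 * (m ∸ ∣ D⁺ ∣ + ∣ D⁺ ∣)             ≡⟨ cong (2 *_) (m∸n+n≡m (∣p∣≤n D⁺)) ⟩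
    2 * m                                 ∎
    where open ≤-Reasoning

theorem4 : ∀ {n m : ℕ} (G : Graph n m) → EdgeTwinFree G → NoIsolatedEdge G →
    ∃[ D ] (IsELTD G D × 3 * ∣ D ∣ ≤ 2 * m)
theorem4 G twin-free no-isolated =
  let D , optimal = Optimality.optimal-exists G ⊤ (Incidence.⊤-valid G no-isolated)
  in Repair.D⁺ G D optimal , Repair.D⁺-eltd G D optimal , Discharging.3∣D⁺∣≤2m G D optimal twin-free
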